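{- Let $\Pi$ be the Fano plane (the projective plane of order $2$), let $(x,M)$ be an anti-flag of $\Pi$ (a point $x$ and a line $M$ with $x$ not incident with $M$), and let $\alpha$ be an automorphism of $\Pi$ of order $3$ which fixes $x$ and $M$ and fixes no other point and no other line. Let $\mathcal{C}_0$ be the point-line geometry obtained from $\Pi$ by removing $M$ and all points incident with $M$, and let $\alpha_0$ be the automorphism of $\mathcal{C}_0$ induced by $\alpha$. Let $\overline{\mathcal{C}}$ be the free completion of $\mathcal{C}_0$ and $\overline{\alpha}$ the automorphism of $\overline{\mathcal{C}}$ obtained by naturally extending $\alpha_0$ through the free construction. Then $\overline{\alpha}$ induces a nontrivial permutation of the set of lines of $\overline{\mathcal{C}}$ incident with $x$, and there is no line $U$ of $\overline{\mathcal{C}}$ not incident with $x$ together with an automorphism $\gamma$ of $\overline{\mathcal{C}}$ fixing $U$ and $x$ such that $\gamma$ and $\overline{\alpha}$ induce the same permutation on the lines incident with $x$.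
   Context: Free completion: given a partial plane $\mathcal{C}_0$ (a point-line geometry in which two points lie on at most one common line), define $\mathcal{C}_1$ by adding, for each pair of distinct lines of $\mathcal{C}_0$ not meeting in a point, a new point incident with exactly these two lines; define $\mathcal{C}_2$ by adding, for each pair of distinct points of $\mathcal{C}_1$ not on a common line, a new line incident with exactly these two points; and continue alternately. The free completion is $\overline{\mathcal{C}} = \bigcup_{i\in\mathbb{N}} \mathcal{C}_i$, a projective plane. An automorphism $\alpha_0$ of $\mathcal{C}_0$ extends step by step to automorphisms $\alpha_i$ of $\mathcal{C}_i$ (a new element added for a pair is sent to the new element added for the image pair), and $\overline{\alpha}$ is the union of the $\alpha_i$. In the terminology of the paper, the permutation induced on lines through $x$ is an automorphism of the "projective type line" $(\overline{\mathcal{C}},x)$, and the conclusion says it is not inherited from any automorphism of an "affine type line" $(\overline{\mathcal{C}}_U,x)$, where $\overline{\mathcal{C}}_U$ is the affine plane obtained by deleting $U$ and its points. -}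

module Defs where

open import Data.Bool using (Bool; true; false; not; _∧_; _∨_; if_then_else_)
open import Data.Nat using (ℕ; zero; suc; _+_; _∸_; _<_; _≡ᵇ_; _<ᵇ_; _≤ᵇ_; _%_)
open import Data.Fin using (Fin; toℕ)
open import Data.List using (List; []; _∷_; length; upTo; allFin; concatMap; map; filterᵇ)
open import Data.Bool.ListAction using (any)
open import Data.Maybe using (Maybe; just; nothing)
open import Data.Product using (Σ; ∃; _×_; _,_; proj₁; proj₂)
open import Relation.Binary.PropositionalEquality using (_≡_)
open import Function.Bundles using (_⇔_)

nth : {A : Set} → List A → ℕ → Maybe A
nth []       _       = nothing
nth (x ∷ xs) zero    = just x
nth (x ∷ xs) (suc i) = nth xs i

-- position of the first element equal (w.r.t. eq) to a; length of list if absent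
idx : {A : Set} → (A → A → Bool) → A → List A → ℕ
idx eq a []       = zero
idx eq a (x ∷ xs) = if eq a x then zero else suc (idx eq a xs)

pairEq : ℕ × ℕ → ℕ × ℕ → Bool
pairEq (a , b) (c , d) = (a ≡ᵇ c) ∧ (b ≡ᵇ d)

-- all unordered pairs {a,b} of distinct numbers < N, written as (a , b) with a < b
allPairs : ℕ → List (ℕ × ℕ)
allPairs N = concatMap (λ b → map (λ a → (a , b)) (upTo b)) (upTo N)

sortPair : ℕ → ℕ → ℕ × ℕ
sortPair a b = if a ≤ᵇ b then (a , b) else (b , a)

memPair : ℕ → Maybe (ℕ × ℕ) → Bool
memPair l nothing        = false
memPair l (just (a , b)) = (l ≡ᵇ a) ∨ (l ≡ᵇ b)

-- Finite partial planes (stages of the free construction).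
-- Points are numbered 0 .. np-1, lines 0 .. nl-1, inc p l = "p is incident with l".

record Stage : Set where
  field
    np  : ℕ
    nl  : ℕ
    inc : ℕ → ℕ → Bool
open Stage public

meets : Stage → ℕ → ℕ → Bool
meets S a b = any (λ p → inc S p a ∧ inc S p b) (upTo (np S))

joined : Stage → ℕ → ℕ → Bool
joined S p q = any (λ l → inc S p l ∧ inc S q l) (upTo (nl S))

newPtPairs : Stage → List (ℕ × ℕ)
newPtPairs S = filterᵇ (λ ab → not (meets S (proj₁ ab) (proj₂ ab))) (allPairs (nl S))

newLnPairs : Stage → List (ℕ × ℕ)
newLnPairs S = filterᵇ (λ pq → not (joined S (proj₁ pq) (proj₂ pq))) (allPairs (np S))

-- add one new point (numbered np S + t) for the t-th non-meeting pair of lines,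
-- incident with exactly these two lines
addPoints : Stage → Stage
addPoints S = record
  { np  = np S + length (newPtPairs S)
  ; nl  = nl S
  ; inc = λ p l → if p <ᵇ np S then inc S p l
                  else memPair l (nth (newPtPairs S) (p ∸ np S)) }

addLines : Stage → Stage
addLines S = record
  { np  = np S
  ; nl  = nl S + length (newLnPairs S)
  ; inc = λ p l → if l <ᵇ nl S then inc S p l
                  else memPair p (nth (newLnPairs S) (l ∸ nl S)) }

record Maps : Set where
  field
    fp : ℕ → ℕ
    fl : ℕ → ℕ
open Maps public

-- extension of an automorphism over addPoints / addLines:
-- the new element of a pair goes to the new element of the image pair
extPoints : Stage → Maps → Maps
extPoints S m = record
  { fp = λ p → if p <ᵇ np S then fp m p
               else np S + img (nth (newPtPairs S) (p ∸ np S))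
  ; fl = fl m }
  where
  img : Maybe (ℕ × ℕ) → ℕ
  img nothing        = zero
  img (just (a , b)) = idx pairEq (sortPair (fl m a) (fl m b)) (newPtPairs S)

extLines : Stage → Maps → Maps
extLines S m = record
  { fp = fp m
  ; fl = λ l → if l <ᵇ nl S then fl m l
               else nl S + img (nth (newLnPairs S) (l ∸ nl S)) }
  where
  img : Maybe (ℕ × ℕ) → ℕ
  img nothing        = zero
  img (just (p , q)) = idx pairEq (sortPair (fp m p) (fp m q)) (newLnPairs S)

isEven : ℕ → Bool
isEven zero    = true
isEven (suc n) = not (isEven n)

module FreeCompletion (C₀ : Stage) where

  C : ℕ → Stage
  C zero    = C₀
  C (suc n) = if isEven n then addPoints (C n) else addLines (C n)

  -- elements of the union 𝒞̄ = ⋃ 𝒞ₙ (numbering is stable along the stages)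
  IsPt : ℕ → Set
  IsPt k = ∃ λ n → k < np (C n)

  IsLn : ℕ → Set
  IsLn l = ∃ λ n → l < nl (C n)

  Inc : ℕ → ℕ → Set
  Inc k l = ∃ λ n → k < np (C n) × l < nl (C n) × inc (C n) k l ≡ true

  record IsAut (f g : ℕ → ℕ) : Set where
    field
      presP : ∀ k → IsPt k → IsPt (f k)
      presL : ∀ l → IsLn l → IsLn (g l)
      injP  : ∀ k k′ → IsPt k → IsPt k′ → f k ≡ f k′ → k ≡ k′
      injL  : ∀ l l′ → IsLn l → IsLn l′ → g l ≡ g l′ → l ≡ l′
      surjP : ∀ k → IsPt k → ∃ λ k′ → IsPt k′ × f k′ ≡ k
      surjL : ∀ l → IsLn l → ∃ λ l′ → IsLn l′ × g l′ ≡ l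
      presI : ∀ k l → IsPt k → IsLn l → (Inc k l ⇔ Inc (f k) (g l))

  module Extension (α₀ : Maps) where
    α : ℕ → Maps
    α zero    = α₀
    α (suc n) = if isEven n then extPoints (C n) (α n) else extLines (C n) (α n)

    ᾱL : ℕ → ℕ → Set
    ᾱL l l′ = ∃ λ n → l < nl (C n) × fl (α n) l ≡ l′

-- The Fano plane: points and lines Fin 7, line l = {l, l+1, l+3} mod 7

IncF : Fin 7 → Fin 7 → Bool
IncF p l = (d ≡ᵇ 0) ∨ (d ≡ᵇ 1) ∨ (d ≡ᵇ 3)
  where d = (7 + toℕ p ∸ toℕ l) % 7

finEq : Fin 7 → Fin 7 → Bool
finEq p q = toℕ p ≡ᵇ toℕ q

-- 𝒞₀ : remove the line M and all points on M; remaining points/lines are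
-- renumbered in increasing order
ptsC₀ : Fin 7 → List (Fin 7)
ptsC₀ M = filterᵇ (λ p → not (IncF p M)) (allFin 7)

lnsC₀ : Fin 7 → List (Fin 7)
lnsC₀ M = filterᵇ (λ l → not (finEq l M)) (allFin 7)

incC₀ : Fin 7 → ℕ → ℕ → Bool
incC₀ M i j with nth (ptsC₀ M) i | nth (lnsC₀ M) j
... | just p | just l = IncF p l
... | _      | _      = false

C₀ : Fin 7 → Stage
C₀ M = record { np = length (ptsC₀ M) ; nl = length (lnsC₀ M) ; inc = incC₀ M }

applyF : (Fin 7 → Fin 7) → List (Fin 7) → ℕ → ℕ
applyF a xs i with nth xs i
... | just p  = idx finEq (a p) xs
... | nothing = i

α₀ : Fin 7 → (Fin 7 → Fin 7) → (Fin 7 → Fin 7) → Maps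
α₀ M aP aL = record { fp = applyF aP (ptsC₀ M) ; fl = applyF aL (lnsC₀ M) }

numPt : Fin 7 → Fin 7 → ℕ
numPt M x = idx finEq x (ptsC₀ M)

{-# OPTIONS --safe #-}
module Submission where

-- If γ agrees with ᾱ on the lines through x, then β = γ⁻¹ᾱ fixes every line through x.  A line
-- off x moved by β would yield a triangle and its image under β in perspective from x with
-- collinear intersections of corresponding sides, i.e. a Desargues configuration with three
-- points on each line and three lines through each point.  A free completion of 𝒞₀ contains no
-- such finite configuration, because an element added last is incident with only two elements.
-- Hence β fixes U, and ᾱ fixes U as γ does.  But ᾱ³ = 1, so ᾱ fixes a new element only if it fixes
-- both elements it was added for; starting from x alone, it never fixes a line.

open import Defs
open import Data.Bool using (Bool; true; false; T; not; if_then_else_; _∧_)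
open import Data.Bool.ListAction using (any)
open import Data.Bool.Properties using (T-≡; T-∧; T-∨; T-not-≡)
import Data.Bool.Properties as Bool
open import Data.Empty using (⊥; ⊥-elim)
open import Data.Fin using (Fin; toℕ)
open import Data.Fin.Properties using (all?; toℕ-injective)
open import Data.List using (List; []; _∷_; length; upTo; map; allFin)
open import Data.List.Membership.Propositional using (_∈_; _∉_; find; lose)
open import Data.List.Membership.Propositional.Properties using (∈-upTo⁺; ∈-upTo⁻; ∈-map⁺; ∈-map⁻; ∈-concatMap⁺; ∈-concatMap⁻; ∈-filter⁺; ∈-filter⁻; ∈-allFin)
open import Data.List.Relation.Unary.All as All using (All; []; _∷_)
import Data.List.Relation.Unary.All.Properties as All
open import Data.List.Relation.Unary.AllPairs using ([]; _∷_)
import Data.List.Relation.Unary.AllPairs.Properties as AllPairs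
open import Data.List.Relation.Unary.Any as Any using (here; there; _─_)
open import Data.List.Relation.Unary.Any.Properties using (any⁺; any⁻)
open import Data.List.Relation.Unary.Unique.Propositional using (Unique)
import Data.List.Relation.Unary.Unique.Propositional.Properties as Unique
open import Data.Maybe using (just)
open import Data.Maybe.Properties using (just-injective)
open import Data.Nat using (ℕ; zero; suc; _+_; _∸_; _⊔_; _<_; _≤_; _<?_; s≤s; z≤n; s<s; s<s⁻¹; _<ᵇ_; _≤ᵇ_; _≡ᵇ_; _≤′_; ≤′-refl; ≤′-step)
open import Data.Nat.Properties
open import Data.Product using (∃; _×_; _,_; proj₁; proj₂)
open import Data.Product.Properties using (,-injectiveˡ; ,-injectiveʳ)
open import Data.Sum using (_⊎_; inj₁; inj₂; [_,_]′)
open import Function using (_∘_; id)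
open import Function.Bundles using (_↔_; Inverse; Equivalence)
open import Relation.Binary.Definitions using (DecidableEquality; tri<; tri≈; tri>)
open import Relation.Binary.PropositionalEquality using (_≡_; _≢_; refl; sym; trans; cong; cong₂; subst; subst₂; ≢-sym)
open import Relation.Nullary using (¬_; Dec; yes; no; contradiction)
import Relation.Nullary.Decidable as Dec
open import Relation.Nullary.Decidable using (toWitness; _→-dec_; _⊎-dec_; _×-dec_; ¬?)

-- Central collineations of open planes

-- A moved line off `x` meets its image in a fixed point and has no other; and if a line off `x`
-- carries two fixed points, it is fixed pointwise, so every moved line must cross it in its own
-- fixed point. The vertices of the triangle must be moved and lie on three different lines through
-- `x`, while the line from `x` to the fixed point of a side has to be avoided. That takes four
-- lines through `x`, whereas joining `x` to the other points of 𝒞₀ gives only three. A fourth comes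
-- from the diagonal points of the quadrangle 𝒞₀: if they were collinear, a Fano plane would arise,
-- and that is itself confined.

pattern ∈₀ = here refl
pattern ∈₁ = there ∈₀
pattern ∈₂ = there ∈₁
pattern ∈₃ = there ∈₂
pattern ∈₄ = there ∈₃
pattern ∈₅ = there ∈₄
pattern ∈₆ = there ∈₅
pattern ∈₇ = there ∈₆
pattern ∈₈ = there ∈₇
pattern ∈₉ = there ∈₈

length-─ : {A : Set} {x : A} {xs : List A} (x∈ : x ∈ xs) → suc (length (xs ─ x∈)) ≡ length xs
length-─ (here _)   = refl
length-─ (there x∈) = cong suc (length-─ x∈)

∈-─ : {A : Set} {x y : A} {xs : List A} (x∈ : x ∈ xs) → y ∈ xs → y ≢ x → y ∈ (xs ─ x∈)
∈-─ (here refl) (here refl) y≢x = contradiction refl y≢x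
∈-─ (here refl) (there y∈)  y≢x = y∈
∈-─ (there x∈)  (here refl) y≢x = here refl
∈-─ (there x∈)  (there y∈)  y≢x = there (∈-─ x∈ y∈ y≢x)

-- Pigeonhole by induction on `xs`: if the head occurs in `ys`, one occurrence is struck out of
-- `ys`. The element found in the tail differs from the head by `Unique`, so striking it out cannot
-- hide that element.
∃-avoiding : {A : Set} → DecidableEquality A → (xs ys : List A) → Unique xs →
             length ys < length xs → ∃ λ x → x ∈ xs × x ∉ ys
∃-avoiding _≟_ (x ∷ xs) ys (x∉xs ∷ xs!) ys<xs with Any.any? (x ≟_) ys
... | no x∉ys = x , here refl , x∉ys
... | yes x∈ys
  with y , y∈xs , y∉ ← ∃-avoiding _≟_ xs (ys ─ x∈ys) xs!
                          (s<s⁻¹ (≤-trans (≤-reflexive (cong suc (length-─ x∈ys))) ys<xs))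
  = y , there y∈xs , λ y∈ys → y∉ (∈-─ x∈ys y∈ys (≢-sym (All.lookup x∉xs y∈xs)))

-- "At least three", the threshold for being confined: an element added by the free construction has
-- only two incidences when it appears.
data Triple {A : Set} (Q : A → Set) (xs : List A) : Set where
  triple : ∀ {a b c} → a ≢ b → a ≢ c → b ≢ c →
           a ∈ xs → b ∈ xs → c ∈ xs → Q a → Q b → Q c → Triple Q xs

-- `unique` is a disjunction, hence its own dual. Equality of lines and incidence are decidable so
-- that the case distinctions of the geometric argument are constructive. Nondegeneracy is supplied
-- separately, by a `Quadrangle`.
record Plane : Set₁ where
  field
    P L    : Set
    I      : P → L → Set
    _≟L_   : DecidableEquality L
    I?     : ∀ p l → Dec (I p l)
    unique : ∀ {p q l m} → I p l → I q l → I p m → I q m → p ≡ q ⊎ l ≡ m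
    join   : ∀ {p q} → p ≢ q → ∃ λ l → I p l × I q l
    meet   : ∀ {l m} → l ≢ m → ∃ λ p → I p l × I p m

  Confined : List P → List L → Set
  Confined ps ls = All (λ p → Triple (I p) ls) ps × All (λ l → Triple (λ p → I p l) ps) ls

  unique-point : ∀ {p q l m} → l ≢ m → I p l → I q l → I p m → I q m → p ≡ q
  unique-point l≢m pl ql pm qm with unique pl ql pm qm
  ... | inj₁ p≡q = p≡q
  ... | inj₂ l≡m = contradiction l≡m l≢m

  unique-line : ∀ {p q l m} → p ≢ q → I p l → I q l → I p m → I q m → l ≡ m
  unique-line p≢q pl ql pm qm with unique pl ql pm qm
  ... | inj₁ p≡q = contradiction p≡q p≢q
  ... | inj₂ l≡m = l≡m

  ∉⇒≢ᴸ : ∀ {p l m} → I p l → ¬ I p m → l ≢ m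
  ∉⇒≢ᴸ pl ¬pm refl = ¬pm pl

  ∉⇒≢ᴾ : ∀ {p q l} → I p l → ¬ I q l → p ≢ q
  ∉⇒≢ᴾ pl ¬ql refl = ¬ql pl

  Noncollinear : P → P → P → Set
  Noncollinear a b c = ∀ {l} → I a l → I b l → ¬ I c l

  -- Open in the sense of the theory of free planes. The head `p` only excludes the empty
  -- configuration, which is confined vacuously.
  Open : Set
  Open = ∀ p ps ls → ¬ Confined (p ∷ ps) ls

-- Quadrangles and four lines through a point

record Quadrangle (Π : Plane) : Set where
  open Plane Π
  field
    x a b c : P
    x≢a     : x ≢ a
    x≢b     : x ≢ b
    x≢c     : x ≢ c
    a≢b     : a ≢ b
    a≢c     : a ≢ c
    b≢c     : b ≢ c
    xab     : Noncollinear x a b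
    xac     : Noncollinear x a c
    xbc     : Noncollinear x b c
    abc     : Noncollinear a b c

-- What the choice of a triangle consumes. When its last vertex is chosen, three lines through `x`
-- are forbidden, hence `four`. Of two points of a thick line other than `x`, at most one lies on a
-- given line off `x`; two thick lines leave one that differs from a given line through `x`.
record RichPencil (Π : Plane) (x : Plane.P Π) : Set where
  open Plane Π
  Thick : L → Set
  Thick l = ∃ λ p → ∃ λ q → I p l × I q l × p ≢ q × x ≢ p × x ≢ q
  field
    pencil   : List L
    distinct : Unique pencil
    four     : length pencil ≡ 4
    through  : All (I x) pencil
    m n      : L
    m≢n      : m ≢ n
    x∈m      : I x m
    x∈n      : I x n
    thick-m  : Thick m
    thick-n  : Thick n

record Collineation (Π : Plane) : Set where
  open Plane Π
  field
    onP      : P → P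
    onL      : L → L
    inj-onP  : ∀ {p q} → onP p ≡ onP q → p ≡ q
    inj-onL  : ∀ {l m} → onL l ≡ onL m → l ≡ m
    pres     : ∀ {p l} → I p l → I (onP p) (onL l)
    reflects : ∀ {p l} → I (onP p) (onL l) → I p l

-- `d`, `e`, `f` are the diagonal points of the complete quadrangle `x`, `a`, `b`, `c`. As second
-- points of `xa` and `xb`, `d` and `e` also make these two lines thick.
module DiagonalPoints (Π : Plane) (Q : Quadrangle Π) (open-Π : Plane.Open Π) where
  open Plane Π
  open Quadrangle Q

  xa = proj₁ (join x≢a)
  x∈xa = proj₁ (proj₂ (join x≢a))
  a∈xa = proj₂ (proj₂ (join x≢a))
  xb = proj₁ (join x≢b)
  x∈xb = proj₁ (proj₂ (join x≢b))
  b∈xb = proj₂ (proj₂ (join x≢b))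
  xc = proj₁ (join x≢c)
  x∈xc = proj₁ (proj₂ (join x≢c))
  c∈xc = proj₂ (proj₂ (join x≢c))
  ab = proj₁ (join a≢b)
  a∈ab = proj₁ (proj₂ (join a≢b))
  b∈ab = proj₂ (proj₂ (join a≢b))
  ac = proj₁ (join a≢c)
  a∈ac = proj₁ (proj₂ (join a≢c))
  c∈ac = proj₂ (proj₂ (join a≢c))
  bc = proj₁ (join b≢c)
  b∈bc = proj₁ (proj₂ (join b≢c))
  c∈bc = proj₂ (proj₂ (join b≢c))

  x∉ab : ¬ I x ab
  x∉ab h = xab h a∈ab b∈ab
  x∉ac : ¬ I x ac
  x∉ac h = xac h a∈ac c∈ac
  x∉bc : ¬ I x bc
  x∉bc h = xbc h b∈bc c∈bc
  a∉xb : ¬ I a xb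
  a∉xb h = xab x∈xb h b∈xb
  a∉xc : ¬ I a xc
  a∉xc h = xac x∈xc h c∈xc
  b∉xc : ¬ I b xc
  b∉xc h = xbc x∈xc h c∈xc
  b∉xa : ¬ I b xa
  b∉xa h = xab x∈xa a∈xa h
  c∉xa : ¬ I c xa
  c∉xa h = xac x∈xa a∈xa h
  c∉xb : ¬ I c xb
  c∉xb h = xbc x∈xb b∈xb h
  c∉ab : ¬ I c ab
  c∉ab h = abc a∈ab b∈ab h
  a∉bc : ¬ I a bc
  a∉bc h = abc h b∈bc c∈bc
  b∉ac : ¬ I b ac
  b∉ac h = abc a∈ac h c∈ac

  xa≢xb : xa ≢ xb
  xa≢xb = ∉⇒≢ᴸ a∈xa a∉xb
  xa≢xc : xa ≢ xc
  xa≢xc = ∉⇒≢ᴸ a∈xa a∉xc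
  xb≢xc : xb ≢ xc
  xb≢xc = ∉⇒≢ᴸ b∈xb b∉xc
  xa≢bc : xa ≢ bc
  xa≢bc = ∉⇒≢ᴸ x∈xa x∉bc
  xb≢ac : xb ≢ ac
  xb≢ac = ∉⇒≢ᴸ x∈xb x∉ac
  xc≢ab : xc ≢ ab
  xc≢ab = ∉⇒≢ᴸ x∈xc x∉ab

  d = proj₁ (meet xa≢bc)
  d∈xa = proj₁ (proj₂ (meet xa≢bc))
  d∈bc = proj₂ (proj₂ (meet xa≢bc))
  e = proj₁ (meet xb≢ac)
  e∈xb = proj₁ (proj₂ (meet xb≢ac))
  e∈ac = proj₂ (proj₂ (meet xb≢ac))
  f = proj₁ (meet xc≢ab)
  f∈xc = proj₁ (proj₂ (meet xc≢ab))
  f∈ab = proj₂ (proj₂ (meet xc≢ab))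

  x≢d : x ≢ d
  x≢d = ≢-sym (∉⇒≢ᴾ d∈bc x∉bc)
  x≢e : x ≢ e
  x≢e = ≢-sym (∉⇒≢ᴾ e∈ac x∉ac)
  x≢f : x ≢ f
  x≢f = ≢-sym (∉⇒≢ᴾ f∈ab x∉ab)
  d≢a : d ≢ a
  d≢a = ∉⇒≢ᴾ d∈bc a∉bc
  d≢b : d ≢ b
  d≢b = ∉⇒≢ᴾ d∈xa b∉xa
  d≢c : d ≢ c
  d≢c = ∉⇒≢ᴾ d∈xa c∉xa
  e≢a : e ≢ a
  e≢a = ∉⇒≢ᴾ e∈xb a∉xb
  e≢b : e ≢ b
  e≢b = ∉⇒≢ᴾ e∈ac b∉ac
  e≢c : e ≢ c
  e≢c = ∉⇒≢ᴾ e∈xb c∉xb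
  f≢a : f ≢ a
  f≢a = ∉⇒≢ᴾ f∈xc a∉xc
  f≢b : f ≢ b
  f≢b = ∉⇒≢ᴾ f∈xc b∉xc
  f≢c : f ≢ c
  f≢c = ∉⇒≢ᴾ f∈ab c∉ab

  d∉xb : ¬ I d xb
  d∉xb h = x≢d (unique-point xa≢xb x∈xa d∈xa x∈xb h)
  e∉xa : ¬ I e xa
  e∉xa h = x≢e (unique-point xa≢xb x∈xa h x∈xb e∈xb)
  f∉xa : ¬ I f xa
  f∉xa h = x≢f (unique-point xa≢xc x∈xa h x∈xc f∈xc)
  f∉xb : ¬ I f xb
  f∉xb h = x≢f (unique-point xb≢xc x∈xb h x∈xc f∈xc)
  d≢e : d ≢ e
  d≢e = ∉⇒≢ᴾ d∈xa e∉xa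
  d≢f : d ≢ f
  d≢f = ∉⇒≢ᴾ d∈xa f∉xa
  e≢f : e ≢ f
  e≢f = ∉⇒≢ᴾ e∈xb f∉xb

  de = proj₁ (join d≢e)
  d∈de = proj₁ (proj₂ (join d≢e))
  e∈de = proj₂ (proj₂ (join d≢e))
  xa≢de : xa ≢ de
  xa≢de = ≢-sym (∉⇒≢ᴸ e∈de e∉xa)
  xb≢de : xb ≢ de
  xb≢de = ≢-sym (∉⇒≢ᴸ d∈de d∉xb)
  a∉de : ¬ I a de
  a∉de h = d≢a (unique-point xa≢de d∈xa a∈xa d∈de h)
  b∉de : ¬ I b de
  b∉de h = e≢b (unique-point xb≢de e∈xb b∈xb e∈de h)
  x∉de : ¬ I x de
  x∉de h = x≢d (unique-point xa≢de x∈xa d∈xa h d∈de)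

  -- With f on de, the quadrangle and its diagonal points would form a Fano plane, which is confined.
  f∉de : ¬ I f de
  f∉de f∈de = open-Π x (a ∷ b ∷ c ∷ d ∷ e ∷ f ∷ []) (xa ∷ xb ∷ xc ∷ ab ∷ ac ∷ bc ∷ de ∷ [])
    ( triple xa≢xb xa≢xc xb≢xc ∈₀ ∈₁ ∈₂ x∈xa x∈xb x∈xc
    ∷ triple (∉⇒≢ᴸ x∈xa x∉ab) (∉⇒≢ᴸ x∈xa x∉ac) (∉⇒≢ᴸ b∈ab b∉ac) ∈₀ ∈₃ ∈₄ a∈xa a∈ab a∈ac
    ∷ triple (∉⇒≢ᴸ x∈xb x∉ab) (∉⇒≢ᴸ x∈xb x∉bc) (∉⇒≢ᴸ a∈ab a∉bc) ∈₁ ∈₃ ∈₅ b∈xb b∈ab b∈bc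
    ∷ triple (∉⇒≢ᴸ x∈xc x∉ac) (∉⇒≢ᴸ x∈xc x∉bc) (∉⇒≢ᴸ a∈ac a∉bc) ∈₂ ∈₄ ∈₅ c∈xc c∈ac c∈bc
    ∷ triple xa≢bc xa≢de (∉⇒≢ᴸ b∈bc b∉de) ∈₀ ∈₅ ∈₆ d∈xa d∈bc d∈de
    ∷ triple xb≢ac xb≢de (∉⇒≢ᴸ a∈ac a∉de) ∈₁ ∈₄ ∈₆ e∈xb e∈ac e∈de
    ∷ triple xc≢ab (∉⇒≢ᴸ x∈xc x∉de) (∉⇒≢ᴸ a∈ab a∉de) ∈₂ ∈₃ ∈₆ f∈xc f∈ab f∈de
    ∷ []
    , triple x≢a x≢d (≢-sym d≢a) ∈₀ ∈₁ ∈₄ x∈xa a∈xa d∈xa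
    ∷ triple x≢b x≢e (≢-sym e≢b) ∈₀ ∈₂ ∈₅ x∈xb b∈xb e∈xb
    ∷ triple x≢c x≢f (≢-sym f≢c) ∈₀ ∈₃ ∈₆ x∈xc c∈xc f∈xc
    ∷ triple a≢b (≢-sym f≢a) (≢-sym f≢b) ∈₁ ∈₂ ∈₆ a∈ab b∈ab f∈ab
    ∷ triple a≢c (≢-sym e≢a) (≢-sym e≢c) ∈₁ ∈₃ ∈₅ a∈ac c∈ac e∈ac
    ∷ triple b≢c (≢-sym d≢b) (≢-sym d≢c) ∈₂ ∈₃ ∈₄ b∈bc c∈bc d∈bc
    ∷ triple d≢e d≢f e≢f ∈₄ ∈₅ ∈₆ d∈de e∈de f∈de
    ∷ [])

  ab≢de : ab ≢ de
  ab≢de = ∉⇒≢ᴸ a∈ab a∉de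
  g = proj₁ (meet ab≢de)
  g∈ab = proj₁ (proj₂ (meet ab≢de))
  g∈de = proj₂ (proj₂ (meet ab≢de))
  x≢g : x ≢ g
  x≢g = ≢-sym (∉⇒≢ᴾ g∈ab x∉ab)
  xg = proj₁ (join x≢g)
  x∈xg = proj₁ (proj₂ (join x≢g))
  g∈xg = proj₂ (proj₂ (join x≢g))
  a≢g : a ≢ g
  a≢g = ≢-sym (∉⇒≢ᴾ g∈de a∉de)
  b≢g : b ≢ g
  b≢g = ≢-sym (∉⇒≢ᴾ g∈de b∉de)
  f≢g : f ≢ g
  f≢g = ≢-sym (∉⇒≢ᴾ g∈de f∉de)
  xa≢xg : xa ≢ xg
  xa≢xg eq = a≢g (unique-point (∉⇒≢ᴸ x∈xa x∉ab) a∈xa (subst (I g) (sym eq) g∈xg) a∈ab g∈ab)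
  xb≢xg : xb ≢ xg
  xb≢xg eq = b≢g (unique-point (∉⇒≢ᴸ x∈xb x∉ab) b∈xb (subst (I g) (sym eq) g∈xg) b∈ab g∈ab)
  -- The inequality that rests on the Fano argument: `f` is where `xc` meets `ab`, so `g` lies on
  -- `xc` only if `g` is `f`, which would put `f` on `de`.
  xc≢xg : xc ≢ xg
  xc≢xg eq = f≢g (unique-point xc≢ab f∈xc (subst (I g) (sym eq) g∈xg) f∈ab g∈ab)

  -- As f is not on de, ab meets de in a point off xc, giving a fourth line through x.
  rich-pencil : RichPencil Π x
  rich-pencil = record
    { pencil = xa ∷ xb ∷ xc ∷ xg ∷ []
    ; distinct = (xa≢xb ∷ xa≢xc ∷ xa≢xg ∷ []) ∷ (xb≢xc ∷ xb≢xg ∷ []) ∷ (xc≢xg ∷ []) ∷ [] ∷ []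
    ; four = refl
    ; through = x∈xa ∷ x∈xb ∷ x∈xc ∷ x∈xg ∷ []
    ; m = xa
    ; n = xb
    ; m≢n = xa≢xb
    ; x∈m = x∈xa
    ; x∈n = x∈xb
    ; thick-m = a , d , a∈xa , d∈xa , ≢-sym d≢a , x≢a , x≢d
    ; thick-n = b , e , b∈xb , e∈xb , ≢-sym e≢b , x≢b , x≢e
    }

-- Collineations fixing every line through a point

module CentralCollineation
  (Π : Plane) (x : Plane.P Π) (R : RichPencil Π x) (open-Π : Plane.Open Π) (β : Collineation Π)
  (central : ∀ {l} → Plane.I Π x l → Collineation.onL β l ≡ l) where
  open Plane Π
  open Collineation β
  open RichPencil R using (pencil; distinct; four; through; Thick)
  open RichPencil R using () renaming (m to m₀; n to n₀; m≢n to m₀≢n₀; x∈m to x∈m₀; x∈n to x∈n₀;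
    thick-m to thick-m₀; thick-n to thick-n₀)

  Fixed : P → Set
  Fixed p = onP p ≡ p

  stays : ∀ {p l} → I x l → I p l → I (onP p) l
  stays {p} xl pl = subst (I (onP p)) (central xl) (pres pl)

  x-fixed : Fixed x
  x-fixed = sym (unique-point m₀≢n₀ x∈m₀ (stays x∈m₀ x∈m₀) x∈n₀ (stays x∈n₀ x∈n₀))

  x∉onL : ∀ {l} → ¬ I x l → ¬ I x (onL l)
  x∉onL {l} x∉l h = x∉l (reflects (subst (λ p → I p (onL l)) (sym x-fixed) h))

  -- `t` and its image both lie on the fixed line joining `x` to `t` and on `onL l`; these lines
  -- differ because `onL l` misses `x`.
  ∈-both⇒fixed : ∀ {l t} → ¬ I x l → I t l → I t (onL l) → Fixed t
  ∈-both⇒fixed {l} {t} x∉l t∈l t∈l′ with join (≢-sym (∉⇒≢ᴾ t∈l x∉l))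
  ... | n , x∈n , t∈n =
    sym (unique-point (∉⇒≢ᴸ x∈n (x∉onL x∉l)) t∈n (stays x∈n t∈n) t∈l′ (pres t∈l))

  fixed⇒∈-image : ∀ {l t} → I t l → Fixed t → I t (onL l)
  fixed⇒∈-image {l} t∈l t-fix = subst (λ p → I p (onL l)) t-fix (pres t∈l)

  -- Every fixed point of `l` also lies on the image of `l`, and two different lines share only one
  -- point.
  fixed-unique : ∀ {l s t} → onL l ≢ l → I s l → I t l → Fixed s → Fixed t → s ≡ t
  fixed-unique l-mov s∈l t∈l s-fix t-fix =
    unique-point (≢-sym l-mov) s∈l t∈l (fixed⇒∈-image s∈l s-fix) (fixed⇒∈-image t∈l t-fix)

  moved-point⇒moved-line : ∀ {l t} → ¬ I x l → I t l → ¬ Fixed t → onL l ≢ l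
  moved-point⇒moved-line {t = t} x∉l t∈l t-mov l-fix =
    t-mov (∈-both⇒fixed x∉l t∈l (subst (I t) (sym l-fix) t∈l))

  fixed-point : ∀ {l} → ¬ I x l → onL l ≢ l → ∃ λ r → I r l × I r (onL l) × Fixed r
  fixed-point x∉l l-mov with meet (≢-sym l-mov)
  ... | r , r∈l , r∈l′ = r , r∈l , r∈l′ , ∈-both⇒fixed x∉l r∈l r∈l′

  fixed-line : ∀ {s t l} → s ≢ t → Fixed s → Fixed t → I s l → I t l → onL l ≡ l
  fixed-line {l = l} s≢t s-fix t-fix s∈l t∈l with onL l ≟L l
  ... | yes eq   = eq
  ... | no l-mov = contradiction (fixed-unique l-mov s∈l t∈l s-fix t-fix) s≢t

  -- `l` joins two fixed points, so it is a fixed line, and being off `x` it is fixed pointwise.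
  -- Hence its meet with the moved line `m` is a fixed point, and `r` is the only one that `m` has.
  fixed-on-axis : ∀ {s t l r m} → s ≢ t → Fixed s → Fixed t → I s l → I t l → ¬ I x l →
                   Fixed r → I r m → onL m ≢ m → I r l
  fixed-on-axis {l = l} {r} {m} s≢t s-fix t-fix s∈l t∈l x∉l r-fix r∈m m-mov
    with l-fix ← fixed-line s≢t s-fix t-fix s∈l t∈l
    with u , u∈l , u∈m ← meet {l} {m} (λ { refl → m-mov l-fix })
    = subst (λ p → I p l)
        (fixed-unique m-mov u∈m r∈m (∈-both⇒fixed x∉l u∈l (subst (I u) (sym l-fix) u∈l)) r-fix) u∈l

  -- The triangle has vertices `p`, `q`, `s`, whose opposite sides are `V`, `W`, `U`; `lp`, `lq`,
  -- `ls` join the vertices to the centre `x`.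
  module MovedTriangle {p q s : P} {U V W lp lq ls : L}
    (p∈U : I p U) (q∈U : I q U) (p∈W : I p W) (s∈W : I s W) (q∈V : I q V) (s∈V : I s V)
    (x∉U : ¬ I x U) (x∉V : ¬ I x V) (x∉W : ¬ I x W)
    (x∈lp : I x lp) (p∈lp : I p lp) (x∈lq : I x lq) (q∈lq : I q lq) (x∈ls : I x ls) (s∈ls : I s ls)
    (lp≢lq : lp ≢ lq) (lp≢ls : lp ≢ ls) (lq≢ls : lq ≢ ls)
    (U≢V : U ≢ V) (U≢W : U ≢ W) (V≢W : V ≢ W) (p≢q : p ≢ q) (p≢s : p ≢ s) (q≢s : q ≢ s)
    (p-mov : ¬ Fixed p) (q-mov : ¬ Fixed q) (s-mov : ¬ Fixed s) where

    U-mov : onL U ≢ U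
    U-mov = moved-point⇒moved-line x∉U p∈U p-mov
    W-mov : onL W ≢ W
    W-mov = moved-point⇒moved-line x∉W p∈W p-mov
    V-mov : onL V ≢ V
    V-mov = moved-point⇒moved-line x∉V q∈V q-mov

    -- A point common to two sides is the vertex `t` that they share, and the vertices are moved.
    perspective-points-distinct : ∀ {l m t r r′} → l ≢ m → I t l → I t m → ¬ Fixed t →
      I r l → I r′ m → Fixed r → r ≢ r′
    perspective-points-distinct l≢m t∈l t∈m t-mov r∈l r∈m r-fix refl =
      t-mov (subst Fixed (unique-point l≢m r∈l t∈l r∈m t∈m) r-fix)

    -- Of three fixed points on the sides, two span a line off x, hence an axis, unless all
    -- three lie on one line through x.
    fixed-collinear : ∀ {r₁ r₂ r₃ A} → r₁ ≢ r₂ → r₁ ≢ r₃ → I r₁ A → I r₂ A →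
      I r₂ W → I r₃ V → r₁ ≢ x → Fixed r₁ → Fixed r₂ → Fixed r₃ → I r₃ A
    fixed-collinear {r₃ = r₃} {A = A} r₁≢r₂ r₁≢r₃ r₁∈A r₂∈A r₂∈W r₃∈V r₁≢x r₁-fix r₂-fix r₃-fix
      with I? x A
    ... | no x∉A = fixed-on-axis r₁≢r₂ r₁-fix r₂-fix r₁∈A r₂∈A x∉A r₃-fix r₃∈V V-mov
    ... | yes x∈A with join r₁≢r₃
    ...   | B , r₁∈B , r₃∈B with B ≟L A
    ...     | yes refl = r₃∈B
    ...     | no B≢A with I? x B
    ...       | no x∉B = contradiction
                (unique-line r₁≢r₂ r₁∈B
                  (fixed-on-axis r₁≢r₃ r₁-fix r₃-fix r₁∈B r₃∈B x∉B r₂-fix r₂∈W W-mov) r₁∈A r₂∈A) B≢A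
    ...       | yes x∈B = contradiction (unique-point B≢A r₁∈B x∈B r₁∈A x∈A) r₁≢x

    -- The ten points are the centre, the two triangles and the three intersections; the ten lines
    -- are three through the centre, six sides and `A`. What remains to be excluded are
    -- coincidences: moved points differ from fixed ones, lines through `x` from lines off `x`, and
    -- `A` carries more fixed points than a moved side can.
    desargues : ∀ {r₁ r₂ r₃ A} → I r₁ U → I r₂ W → I r₃ V → Fixed r₁ → Fixed r₂ → Fixed r₃ →
      r₁ ≢ r₂ → r₁ ≢ r₃ → r₂ ≢ r₃ → I r₁ A → I r₂ A → I r₃ A → ⊥
    desargues {r₁} {r₂} {r₃} {A} r₁∈U r₂∈W r₃∈V r₁-fix r₂-fix r₃-fix r₁≢r₂ r₁≢r₃ r₂≢r₃ r₁∈A r₂∈A r₃∈A =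
      open-Π x (p ∷ q ∷ s ∷ onP p ∷ onP q ∷ onP s ∷ r₁ ∷ r₂ ∷ r₃ ∷ [])
        (lp ∷ lq ∷ ls ∷ U ∷ V ∷ W ∷ onL U ∷ onL V ∷ onL W ∷ A ∷ [])
        -- One entry for each point, then one for each line, in the order of the two lists; the
        -- indices of the patterns `∈₀` to `∈₉` are positions in the list of the other kind.
        ( triple lp≢lq lp≢ls lq≢ls ∈₀ ∈₁ ∈₂ x∈lp x∈lq x∈ls
        ∷ triple (∉⇒≢ᴸ x∈lp x∉U) (∉⇒≢ᴸ x∈lp x∉W) U≢W ∈₀ ∈₃ ∈₅ p∈lp p∈U p∈W
        ∷ triple (∉⇒≢ᴸ x∈lq x∉U) (∉⇒≢ᴸ x∈lq x∉V) U≢V ∈₁ ∈₃ ∈₄ q∈lq q∈U q∈V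
        ∷ triple (∉⇒≢ᴸ x∈ls x∉V) (∉⇒≢ᴸ x∈ls x∉W) V≢W ∈₂ ∈₄ ∈₅ s∈ls s∈V s∈W
        ∷ triple (x∉⇒≢onL x∈lp x∉U) (x∉⇒≢onL x∈lp x∉W) (U≢W ∘ inj-onL) ∈₀ ∈₆ ∈₈
            (stays x∈lp p∈lp) (pres p∈U) (pres p∈W)
        ∷ triple (x∉⇒≢onL x∈lq x∉U) (x∉⇒≢onL x∈lq x∉V) (U≢V ∘ inj-onL) ∈₁ ∈₆ ∈₇
            (stays x∈lq q∈lq) (pres q∈U) (pres q∈V)
        ∷ triple (x∉⇒≢onL x∈ls x∉V) (x∉⇒≢onL x∈ls x∉W) (V≢W ∘ inj-onL) ∈₂ ∈₇ ∈₈
            (stays x∈ls s∈ls) (pres s∈V) (pres s∈W)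
        ∷ fixed-triple ∈₃ ∈₆ U-mov r₁∈U r₁-fix r₁∈A r₂∈A r₂-fix r₁≢r₂
        ∷ fixed-triple ∈₅ ∈₈ W-mov r₂∈W r₂-fix r₂∈A r₁∈A r₁-fix (≢-sym r₁≢r₂)
        ∷ fixed-triple ∈₄ ∈₇ V-mov r₃∈V r₃-fix r₃∈A r₁∈A r₁-fix (≢-sym r₁≢r₃)
        ∷ []
        , central-triple ∈₁ ∈₄ x∈lp p∈lp (∉⇒≢ᴾ p∈U x∉U) p-mov
        ∷ central-triple ∈₂ ∈₅ x∈lq q∈lq (∉⇒≢ᴾ q∈U x∉U) q-mov
        ∷ central-triple ∈₃ ∈₆ x∈ls s∈ls (∉⇒≢ᴾ s∈W x∉W) s-mov
        ∷ triple p≢q (mov≢fix p-mov r₁-fix) (mov≢fix q-mov r₁-fix) ∈₁ ∈₂ ∈₇ p∈U q∈U r₁∈U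
        ∷ triple q≢s (mov≢fix q-mov r₃-fix) (mov≢fix s-mov r₃-fix) ∈₂ ∈₃ ∈₉ q∈V s∈V r₃∈V
        ∷ triple p≢s (mov≢fix p-mov r₂-fix) (mov≢fix s-mov r₂-fix) ∈₁ ∈₃ ∈₈ p∈W s∈W r₂∈W
        ∷ triple (p≢q ∘ inj-onP) (mov≢fix′ p-mov r₁-fix) (mov≢fix′ q-mov r₁-fix) ∈₄ ∈₅ ∈₇
            (pres p∈U) (pres q∈U) (fixed⇒∈-image r₁∈U r₁-fix)
        ∷ triple (q≢s ∘ inj-onP) (mov≢fix′ q-mov r₃-fix) (mov≢fix′ s-mov r₃-fix) ∈₅ ∈₆ ∈₉
            (pres q∈V) (pres s∈V) (fixed⇒∈-image r₃∈V r₃-fix)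
        ∷ triple (p≢s ∘ inj-onP) (mov≢fix′ p-mov r₂-fix) (mov≢fix′ s-mov r₂-fix) ∈₄ ∈₆ ∈₈
            (pres p∈W) (pres s∈W) (fixed⇒∈-image r₂∈W r₂-fix)
        ∷ triple r₁≢r₂ r₁≢r₃ r₂≢r₃ ∈₇ ∈₈ ∈₉ r₁∈A r₂∈A r₃∈A
        ∷ [])
      where
      x∉⇒≢onL : ∀ {l m} → I x l → ¬ I x m → l ≢ onL m
      x∉⇒≢onL x∈l x∉m = ∉⇒≢ᴸ x∈l (x∉onL x∉m)
      mov≢fix : ∀ {t r} → ¬ Fixed t → Fixed r → t ≢ r
      mov≢fix t-mov r-fix refl = t-mov r-fix
      mov≢fix′ : ∀ {t r} → ¬ Fixed t → Fixed r → onP t ≢ r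
      mov≢fix′ t-mov r-fix eq = mov≢fix t-mov r-fix (inj-onP (trans eq (sym r-fix)))

      -- The three lines are a side, its image and `A`. The second fixed point `r′` of `A` lies on
      -- neither of the other two, so `A` is different from both.
      fixed-triple : ∀ {l r r′} →
        l ∈ (lp ∷ lq ∷ ls ∷ U ∷ V ∷ W ∷ onL U ∷ onL V ∷ onL W ∷ A ∷ []) →
        onL l ∈ (lp ∷ lq ∷ ls ∷ U ∷ V ∷ W ∷ onL U ∷ onL V ∷ onL W ∷ A ∷ []) →
        onL l ≢ l → I r l → Fixed r → I r A → I r′ A → Fixed r′ → r ≢ r′ →
        Triple (I r) (lp ∷ lq ∷ ls ∷ U ∷ V ∷ W ∷ onL U ∷ onL V ∷ onL W ∷ A ∷ [])
      fixed-triple {l} {r} {r′} l∈ l′∈ l-mov r∈l r-fix r∈A r′∈A r′-fix r≢r′ =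
        triple (≢-sym l-mov) (∉⇒≢-A r′∉l) (∉⇒≢-A r′∉l′) l∈ l′∈ ∈₉ r∈l (fixed⇒∈-image r∈l r-fix) r∈A
        where
        r′∉l : ¬ I r′ l
        r′∉l r′∈l = r≢r′ (fixed-unique l-mov r∈l r′∈l r-fix r′-fix)
        r′∉l′ : ¬ I r′ (onL l)
        r′∉l′ r′∈l′ = r′∉l (reflects (subst (λ t → I t (onL l)) (sym r′-fix) r′∈l′))
        ∉⇒≢-A : ∀ {m} → ¬ I r′ m → m ≢ A
        ∉⇒≢-A r′∉m = ≢-sym (∉⇒≢ᴸ r′∈A r′∉m)

      central-triple : ∀ {t l} →
        t ∈ (x ∷ p ∷ q ∷ s ∷ onP p ∷ onP q ∷ onP s ∷ r₁ ∷ r₂ ∷ r₃ ∷ []) →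
        onP t ∈ (x ∷ p ∷ q ∷ s ∷ onP p ∷ onP q ∷ onP s ∷ r₁ ∷ r₂ ∷ r₃ ∷ []) →
        I x l → I t l → t ≢ x → ¬ Fixed t →
        Triple (λ u → I u l) (x ∷ p ∷ q ∷ s ∷ onP p ∷ onP q ∷ onP s ∷ r₁ ∷ r₂ ∷ r₃ ∷ [])
      central-triple t∈ t′∈ x∈l t∈l t≢x t-mov =
        triple (≢-sym t≢x) (≢-sym (mov≢fix′ t-mov x-fixed)) (≢-sym t-mov) ∈₀ t∈ t′∈ x∈l t∈l (stays x∈l t∈l)

    -- pqs and its image are in perspective from x, and corresponding sides meet in collinear
    -- fixed points: a Desargues configuration, which is confined.
    impossible : ⊥
    impossible
      with r₁ , r₁∈U , _ , r₁-fix ← fixed-point x∉U U-mov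
         | r₂ , r₂∈W , _ , r₂-fix ← fixed-point x∉W W-mov
         | r₃ , r₃∈V , _ , r₃-fix ← fixed-point x∉V V-mov
      with r₁≢r₂ ← perspective-points-distinct U≢W p∈U p∈W p-mov r₁∈U r₂∈W r₁-fix
         | r₁≢r₃ ← perspective-points-distinct U≢V q∈U q∈V q-mov r₁∈U r₃∈V r₁-fix
         | r₂≢r₃ ← perspective-points-distinct (≢-sym V≢W) s∈W s∈V s-mov r₂∈W r₃∈V r₂-fix
      with A , r₁∈A , r₂∈A ← join r₁≢r₂
      = desargues r₁∈U r₂∈W r₃∈V r₁-fix r₂-fix r₃-fix r₁≢r₂ r₁≢r₃ r₂≢r₃ r₁∈A r₂∈A
          (fixed-collinear r₁≢r₂ r₁≢r₃ r₁∈A r₂∈A r₂∈W r₃∈V (∉⇒≢ᴾ r₁∈U x∉U) r₁-fix r₂-fix r₃-fix)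

  third-point-off : ∀ {l U} → I x l → Thick l → ¬ I x U → ∃ λ t → I t l × ¬ I t U × x ≢ t
  third-point-off {l} {U} x∈l (p , q , p∈l , q∈l , p≢q , x≢p , x≢q) x∉U with I? p U
  ... | no p∉U = p , p∈l , p∉U , x≢p
  ... | yes p∈U = q , q∈l , (λ q∈U → p≢q (unique-point (∉⇒≢ᴸ x∈l x∉U) p∈l q∈l p∈U q∈U)) , x≢q

  point-off : ∀ {U lp} → ¬ I x U → ∃ λ t → ¬ I t U × x ≢ t × ∃ λ l → l ≢ lp × I x l × I t l
  point-off {lp = lp} x∉U with m₀ ≟L lp
  ... | no m₀≢lp with third-point-off x∈m₀ thick-m₀ x∉U
  ...   | t , t∈m₀ , t∉U , x≢t = t , t∉U , x≢t , m₀ , m₀≢lp , x∈m₀ , t∈m₀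
  point-off {lp = lp} x∉U | yes refl with third-point-off x∈n₀ thick-n₀ x∉U
  ...   | t , t∈n₀ , t∉U , x≢t = t , t∉U , x≢t , n₀ , ≢-sym m₀≢n₀ , x∈n₀ , t∈n₀

  -- Vertices are found as traces on `U` of lines through `x`; `ns` holds the lines that would give
  -- an unsuitable trace.
  project : ∀ {U} ns → length ns < 4 → ¬ I x U →
            ∃ λ t → I t U × ∃ λ l → I x l × I t l × l ∉ ns
  project {U} ns ns<4 x∉U
    with l , l∈ls , l∉ns ← ∃-avoiding _≟L_ pencil ns distinct (≤-trans ns<4 (≤-reflexive (sym four)))
    with t , t∈l , t∈U ← meet (∉⇒≢ᴸ (All.lookup through l∈ls) x∉U)
    = t , t∈U , l , All.lookup through l∈ls , t∈l , l∉ns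

  -- A moved `U` becomes a side of the triangle. It has the single fixed point `r`, so its points on
  -- lines through `x` other than `xr` are moved; two of them serve as `p` and `q`. The third vertex
  -- is found in the same way on a second line `W` through `p`.
  fixes-lines : ∀ {U} → ¬ I x U → onL U ≡ U
  fixes-lines {U} x∉U with onL U ≟L U
  ... | yes U-fix = U-fix
  ... | no U-mov
    with r , r∈U , _ , r-fix ← fixed-point x∉U U-mov
    with xr , x∈xr , r∈xr ← join (≢-sym (∉⇒≢ᴾ r∈U x∉U))
    with p , p∈U , lp , x∈lp , p∈lp , lp∉ ← project (xr ∷ []) (s≤s (s≤s z≤n)) x∉U
    with q , q∈U , lq , x∈lq , q∈lq , lq∉ ← project (xr ∷ lp ∷ []) (s≤s (s≤s (s≤s z≤n))) x∉U
    -- `t` lies on a line through `x` other than `lp`, so that the line `W` joining `p` to `t`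
    -- misses `x`; being off `U`, it makes `W` differ from `U`.
    with t , t∉U , x≢t , N , N≢lp , x∈N , t∈N ← point-off {lp = lp} x∉U
    with W , p∈W , t∈W ← join (∉⇒≢ᴾ p∈U t∉U)
    = ⊥-elim absurd
    where
    on-same : ∀ {u v l m n} → ¬ I x n → I u n → I x l → I x m → I u l → I v m → u ≡ v → l ≡ m
    on-same x∉n u∈n x∈l x∈m u∈l v∈m refl = unique-line (≢-sym (∉⇒≢ᴾ u∈n x∉n)) x∈l u∈l x∈m v∈m
    moved : ∀ {u r n l xr} → ¬ I x n → onL n ≢ n → I r n → Fixed r → I u n →
            I x l → I u l → I x xr → I r xr → l ≢ xr → ¬ Fixed u
    moved x∉n n-mov r∈n r-fix u∈n x∈l u∈l x∈xr r∈xr l≢xr u-fix =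
      l≢xr (on-same x∉n u∈n x∈l x∈xr u∈l r∈xr (fixed-unique n-mov u∈n r∈n u-fix r-fix))
    p-mov : ¬ Fixed p
    p-mov = moved x∉U U-mov r∈U r-fix p∈U x∈lp p∈lp x∈xr r∈xr (λ eq → lp∉ (here eq))
    q-mov : ¬ Fixed q
    q-mov = moved x∉U U-mov r∈U r-fix q∈U x∈lq q∈lq x∈xr r∈xr (λ eq → lq∉ (here eq))
    W≢U : W ≢ U
    W≢U = ∉⇒≢ᴸ t∈W t∉U
    x∉W : ¬ I x W
    x∉W x∈W with refl ← unique-line x≢t x∈W t∈W x∈N t∈N =
      N≢lp (unique-line (≢-sym (∉⇒≢ᴾ p∈U x∉U)) x∈N p∈W x∈lp p∈lp)
    W-mov : onL W ≢ W
    W-mov = moved-point⇒moved-line x∉W p∈W p-mov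
    absurd : ⊥
    absurd
      with r′ , r′∈W , _ , r′-fix ← fixed-point x∉W W-mov
      with xr′ , x∈xr′ , r′∈xr′ ← join (≢-sym (∉⇒≢ᴾ r′∈W x∉W))
      -- Avoiding `xr′` makes `s` moved; avoiding `lp` and `lq` puts the three vertices on different
      -- lines through `x`.
      with s , s∈W , ls , x∈ls , s∈ls , ls∉ ← project (xr′ ∷ lp ∷ lq ∷ []) (s≤s (s≤s (s≤s (s≤s z≤n)))) x∉W
      = desargues
      where
      lp≢ls : lp ≢ ls
      lp≢ls eq = ls∉ (there (here (sym eq)))
      lq≢ls : lq ≢ ls
      lq≢ls eq = ls∉ (there (there (here (sym eq))))
      lp≢lq : lp ≢ lq
      lp≢lq eq = lq∉ (there (here (sym eq)))
      p≢s : p ≢ s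
      p≢s eq = lp≢ls (on-same x∉U p∈U x∈lp x∈ls p∈lp s∈ls eq)
      p≢q : p ≢ q
      p≢q eq = lp≢lq (on-same x∉U p∈U x∈lp x∈lq p∈lp q∈lq eq)
      q≢s : q ≢ s
      q≢s eq = lq≢ls (on-same x∉U q∈U x∈lq x∈ls q∈lq s∈ls eq)
      s∉U : ¬ I s U
      s∉U s∈U = p≢s (unique-point W≢U p∈W s∈W p∈U s∈U)
      V = proj₁ (join q≢s)
      q∈V = proj₁ (proj₂ (join q≢s))
      s∈V = proj₂ (proj₂ (join q≢s))
      x∉V : ¬ I x V
      x∉V x∈V = lq≢ls (trans (unique-line (≢-sym (∉⇒≢ᴾ q∈U x∉U)) x∈lq q∈lq x∈V q∈V)
                             (unique-line (≢-sym (∉⇒≢ᴾ s∈W x∉W)) x∈V s∈V x∈ls s∈ls))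
      V≢W : V ≢ W
      V≢W eq = p≢q (unique-point W≢U p∈W (subst (I q) eq q∈V) p∈U q∈U)
      desargues : ⊥
      desargues = MovedTriangle.impossible p∈U q∈U p∈W s∈W q∈V s∈V x∉U x∉V x∉W
        x∈lp p∈lp x∈lq q∈lq x∈ls s∈ls lp≢lq lp≢ls lq≢ls
        (≢-sym (∉⇒≢ᴸ s∈V s∉U)) (≢-sym W≢U) V≢W p≢q p≢s q≢s p-mov q-mov
        (moved x∉W W-mov r′∈W r′-fix s∈W x∈ls s∈ls x∈xr′ r′∈xr′ (λ eq → ls∉ (here eq)))

-- One step of the free construction

nth-∈ : {A : Set} {a : A} (xs : List A) (i : ℕ) → nth xs i ≡ just a → a ∈ xs
nth-∈ (x ∷ xs) zero    refl = here refl
nth-∈ (x ∷ xs) (suc i) eq   = there (nth-∈ xs i eq)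

nth⇒< : {A : Set} {a : A} (xs : List A) (i : ℕ) → nth xs i ≡ just a → i < length xs
nth⇒< (x ∷ xs) zero    eq = s≤s z≤n
nth⇒< (x ∷ xs) (suc i) eq = s≤s (nth⇒< xs i eq)

<⇒nth : {A : Set} (xs : List A) {i : ℕ} → i < length xs → ∃ λ a → nth xs i ≡ just a
<⇒nth (x ∷ xs) {zero}  _  = x , refl
<⇒nth (x ∷ xs) {suc i} lt = <⇒nth xs (s<s⁻¹ lt)

nth-injective : {A : Set} {a : A} {xs : List A} → Unique xs → ∀ i j →
                nth xs i ≡ just a → nth xs j ≡ just a → i ≡ j
nth-injective (x∉ ∷ xs!) zero    zero    p q = refl
nth-injective (x∉ ∷ xs!) zero    (suc j) refl q = contradiction refl (All.lookup x∉ (nth-∈ _ j q))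
nth-injective (x∉ ∷ xs!) (suc i) zero    p refl = contradiction refl (All.lookup x∉ (nth-∈ _ i p))
nth-injective (x∉ ∷ xs!) (suc i) (suc j) p q = cong suc (nth-injective xs! i j p q)

record DecidesEq {A : Set} (eq : A → A → Bool) : Set where
  field
    sound    : ∀ {a b} → T (eq a b) → a ≡ b
    complete : ∀ a → T (eq a a)

nth-idx : {A : Set} {eq : A → A → Bool} → DecidesEq eq → {a : A} {xs : List A} →
          a ∈ xs → nth xs (idx eq a xs) ≡ just a
nth-idx {eq = eq} D {a} {x ∷ xs} a∈ with eq a x in e
... | true = cong just (sym (DecidesEq.sound D (Equivalence.from T-≡ e)))
nth-idx {eq = eq} D {a} {x ∷ xs} (here refl) | false =
  ⊥-elim (subst T e (DecidesEq.complete D a))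
nth-idx D (there a∈) | false = nth-idx D a∈

pairEq-decides : DecidesEq pairEq
pairEq-decides = record
  { sound    = λ {(a , b)} {(c , d)} t → let t₁ , t₂ = Equivalence.to (T-∧ {a ≡ᵇ c}) t
                                         in cong₂ _,_ (≡ᵇ⇒≡ a c t₁) (≡ᵇ⇒≡ b d t₂)
  ; complete = λ (a , b) → Equivalence.from (T-∧ {a ≡ᵇ a}) (≡⇒≡ᵇ a a refl , ≡⇒≡ᵇ b b refl) }

any-upTo⁺ : ∀ (f : ℕ → Bool) {n i} → i < n → f i ≡ true → any f (upTo n) ≡ true
any-upTo⁺ f i<n fi = Equivalence.to T-≡ (any⁺ f (lose (∈-upTo⁺ i<n) (Equivalence.from T-≡ fi)))

any-upTo⁻ : ∀ (f : ℕ → Bool) {n} → any f (upTo n) ≡ true → ∃ λ i → i < n × f i ≡ true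
any-upTo⁻ f {n} eq with i , i∈ , fi ← find (any⁻ f (upTo n) (Equivalence.from T-≡ eq)) =
  i , ∈-upTo⁻ i∈ , Equivalence.to T-≡ fi

∧-true⁻ : ∀ {a b} → a ∧ b ≡ true → a ≡ true × b ≡ true
∧-true⁻ {true} eq = refl , eq

∧-true⁺ : ∀ {a b} → a ≡ true → b ≡ true → a ∧ b ≡ true
∧-true⁺ refl refl = refl

if-< : {A : Set} {m n : ℕ} {a b : A} → m < n → (if m <ᵇ n then a else b) ≡ a
if-< {m = m} {n} m<n with m <ᵇ n | <⇒<ᵇ m<n
... | true | _ = refl

if-≥ : {A : Set} {m n : ℕ} {a b : A} → n ≤ m → (if m <ᵇ n then a else b) ≡ b
if-≥ {m = m} {n} n≤m with m <ᵇ n in e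
... | false = refl
... | true  = contradiction (<ᵇ⇒< m n (Equivalence.from T-≡ e)) (≤⇒≯ n≤m)

∈-allPairs⁺ : ∀ {N a b} → a < b → b < N → (a , b) ∈ allPairs N
∈-allPairs⁺ {N} a<b b<N = ∈-concatMap⁺ _ (lose (∈-upTo⁺ b<N) (∈-map⁺ _ (∈-upTo⁺ a<b)))

∈-allPairs⁻ : ∀ {N a b} → (a , b) ∈ allPairs N → a < b × b < N
∈-allPairs⁻ {N} ab∈ with b , b∈ , ab∈′ ← find (∈-concatMap⁻ (λ b → map (_, b) (upTo b)) {xs = upTo N} ab∈)
  with _ , a∈ , refl ← ∈-map⁻ (_, b) ab∈′ = ∈-upTo⁻ a∈ , ∈-upTo⁻ b∈

-- Pairs from different blocks differ in the second entry, pairs within a block in the first.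
allPairs! : ∀ N → Unique (allPairs N)
allPairs! N = Unique.concat⁺
  (All.map⁺ (All.universal (λ b → Unique.map⁺ ,-injectiveˡ (Unique.upTo⁺ b)) (upTo N)))
  (AllPairs.map⁺ (AllPairs.applyUpTo⁺₁ id N (λ i<j _ (v∈i , v∈j) → disjoint i<j v∈i v∈j)))
  where
  disjoint : ∀ {i j v} → i < j → v ∈ map (_, i) (upTo i) → v ∈ map (_, j) (upTo j) → ⊥
  disjoint {i} {j} i<j v∈i v∈j with _ , _ , refl ← ∈-map⁻ (_, i) v∈i with _ , _ , e ← ∈-map⁻ (_, j) v∈j =
    <⇒≢ i<j (,-injectiveʳ e)

sortPair-< : ∀ {a b} → a < b → sortPair a b ≡ (a , b)
sortPair-< {a} {b} a<b with a ≤ᵇ b | ≤⇒≤ᵇ (<⇒≤ a<b)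
... | true | _ = refl

sortPair-> : ∀ {a b} → b < a → sortPair a b ≡ (b , a)
sortPair-> {a} {b} b<a with a ≤ᵇ b in e
... | false = refl
... | true  = contradiction (≤ᵇ⇒≤ a b (Equivalence.from T-≡ e)) (<⇒≱ b<a)

sortPair-comm : ∀ a b → sortPair a b ≡ sortPair b a
sortPair-comm a b with <-cmp a b
... | tri< a<b _ _ = trans (sortPair-< a<b) (sym (sortPair-> a<b))
... | tri≈ _ refl _ = refl
... | tri> _ _ b<a = trans (sortPair-> b<a) (sym (sortPair-< b<a))

-- The action of `g` on unordered pairs, which are coded in increasing order.
image : (ℕ → ℕ) → ℕ × ℕ → ℕ × ℕ
image g (a , b) = sortPair (g a) (g b)

image-sortPair : ∀ g a b → image g (sortPair a b) ≡ sortPair (g a) (g b)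
image-sortPair g a b with a ≤ᵇ b
... | true  = refl
... | false = sortPair-comm (g b) (g a)

_∈ᵖ_ : ℕ → ℕ × ℕ → Set
l ∈ᵖ (a , b) = l ≡ a ⊎ l ≡ b

∈ᵖ-sortPair : ∀ {l} a b → l ∈ᵖ (a , b) → l ∈ᵖ sortPair a b
∈ᵖ-sortPair a b l∈ with a ≤ᵇ b
... | true = l∈
∈ᵖ-sortPair a b (inj₁ e) | false = inj₂ e
∈ᵖ-sortPair a b (inj₂ e) | false = inj₁ e

∈ᵖ⇒sortPair : ∀ {l m a b} → a < b → l ≢ m → l ∈ᵖ (a , b) → m ∈ᵖ (a , b) → sortPair l m ≡ (a , b)
∈ᵖ⇒sortPair a<b l≢m (inj₁ refl) (inj₁ refl) = contradiction refl l≢m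
∈ᵖ⇒sortPair a<b l≢m (inj₁ refl) (inj₂ refl) = sortPair-< a<b
∈ᵖ⇒sortPair a<b l≢m (inj₂ refl) (inj₁ refl) = sortPair-> a<b
∈ᵖ⇒sortPair a<b l≢m (inj₂ refl) (inj₂ refl) = contradiction refl l≢m

no-three-in-pair : ∀ {k l m e} → k ≢ l → k ≢ m → l ≢ m → k ∈ᵖ e → l ∈ᵖ e → m ∈ᵖ e → ⊥
no-three-in-pair k≢l k≢m l≢m (inj₁ refl) (inj₁ refl) _ = k≢l refl
no-three-in-pair k≢l k≢m l≢m (inj₁ refl) (inj₂ refl) (inj₁ refl) = k≢m refl
no-three-in-pair k≢l k≢m l≢m (inj₁ refl) (inj₂ refl) (inj₂ refl) = l≢m refl
no-three-in-pair k≢l k≢m l≢m (inj₂ refl) (inj₁ refl) (inj₁ refl) = l≢m refl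
no-three-in-pair k≢l k≢m l≢m (inj₂ refl) (inj₁ refl) (inj₂ refl) = k≢m refl
no-three-in-pair k≢l k≢m l≢m (inj₂ refl) (inj₂ refl) _ = k≢l refl

memPair⁻ : ∀ l e → memPair l (just e) ≡ true → l ∈ᵖ e
memPair⁻ l (a , b) eq with Equivalence.to (T-∨ {l ≡ᵇ a}) (Equivalence.from T-≡ eq)
... | inj₁ t = inj₁ (≡ᵇ⇒≡ l a t)
... | inj₂ t = inj₂ (≡ᵇ⇒≡ l b t)

memPair⁺ : ∀ l e → l ∈ᵖ e → memPair l (just e) ≡ true
memPair⁺ l (a , b) (inj₁ e) = Equivalence.to T-≡ (Equivalence.from T-∨ (inj₁ (≡⇒≡ᵇ l a e)))
memPair⁺ l (a , b) (inj₂ e) = Equivalence.to T-≡ (Equivalence.from (T-∨ {l ≡ᵇ a}) (inj₂ (≡⇒≡ᵇ l b e)))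

-- Since addLines S is definitionally dual (addPoints (dual S)), each statement about addPoints
-- yields its dual for addLines.
dual : Stage → Stage
dual S = record { np = nl S ; nl = np S ; inc = λ p l → inc S l p }

dualMaps : Maps → Maps
dualMaps m = record { fp = fl m ; fl = fp m }

module _ (S : Stage) where

  newPtPairs! : Unique (newPtPairs S)
  newPtPairs! = Unique.filter⁺ _ (allPairs! (nl S))

  ∈-newPtPairs⁺ : ∀ {a b} → a < b → b < nl S → meets S a b ≡ false → (a , b) ∈ newPtPairs S
  ∈-newPtPairs⁺ a<b b<nl ¬meet = ∈-filter⁺ _ (∈-allPairs⁺ a<b b<nl) (Equivalence.from T-not-≡ ¬meet)

  ∈-newPtPairs⁻ : ∀ {a b} → (a , b) ∈ newPtPairs S → a < b × b < nl S × meets S a b ≡ false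
  ∈-newPtPairs⁻ ab∈ with ab∈′ , t ← ∈-filter⁻ _ {xs = allPairs (nl S)} ab∈ with a<b , b<nl ← ∈-allPairs⁻ ab∈′ =
    a<b , b<nl , Equivalence.to T-not-≡ t

  meets⁺ : ∀ {p a b} → p < np S → inc S p a ≡ true → inc S p b ≡ true → meets S a b ≡ true
  meets⁺ p< pa pb = any-upTo⁺ _ p< (∧-true⁺ pa pb)

  meets⁻ : ∀ {a b} → meets S a b ≡ true → ∃ λ p → p < np S × inc S p a ≡ true × inc S p b ≡ true
  meets⁻ eq with p , p< , e ← any-upTo⁻ _ eq = p , p< , ∧-true⁻ e

  meets-comm : ∀ {a b} → meets S a b ≡ false → meets S b a ≡ false
  meets-comm {a} {b} ¬ab with meets S b a in e
  ... | false = refl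
  ... | true with p , p< , pb , pa ← meets⁻ e with () ← trans (sym ¬ab) (meets⁺ p< pa pb)

  -- `p` is the point added for the pair `e`. The lower bound matters because `∸` truncates: without
  -- it, every old point would be read as the first new one.
  New : ℕ → ℕ × ℕ → Set
  New p e = np S ≤ p × nth (newPtPairs S) (p ∸ np S) ≡ just e

  New-< : ∀ {p e} → New p e → p < np (addPoints S)
  New-< (np≤p , eq) = subst (_< np (addPoints S)) (m+[n∸m]≡n np≤p) (+-monoʳ-< (np S) (nth⇒< (newPtPairs S) _ eq))

  New-unique : ∀ {p q e} → New p e → New q e → p ≡ q
  New-unique (np≤p , eq) (np≤q , eq′) =
    ∸-cancelʳ-≡ np≤p np≤q (nth-injective newPtPairs! _ _ eq eq′)

  New-fun : ∀ {p e e′} → New p e → New p e′ → e ≡ e′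
  New-fun (_ , eq) (_ , eq′) = just-injective (trans (sym eq) eq′)

  New-∈ : ∀ {p a b} → New p (a , b) → a < b × b < nl S × meets S a b ≡ false
  New-∈ (_ , eq) = ∈-newPtPairs⁻ (nth-∈ _ _ eq)

  ∈⇒New : ∀ {e} → e ∈ newPtPairs S → New (np S + idx pairEq e (newPtPairs S)) e
  ∈⇒New {e} e∈ = m≤m+n _ _ ,
    trans (cong (nth (newPtPairs S)) (m+n∸m≡n (np S) _)) (nth-idx pairEq-decides e∈)

  old-or-new : ∀ {p} → p < np (addPoints S) → p < np S ⊎ ∃ (New p)
  old-or-new {p} p< with p <? np S
  ... | yes p<np = inj₁ p<np
  ... | no p≮np with np≤p ← ≮⇒≥ p≮np
                with e , eq ← <⇒nth (newPtPairs S) {p ∸ np S}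
                       (subst (p ∸ np S <_) (m+n∸m≡n (np S) _) (∸-monoˡ-< p< np≤p)) = inj₂ (e , np≤p , eq)

  inc-old : ∀ {p l} → p < np S → inc (addPoints S) p l ≡ inc S p l
  inc-old p< = if-< p<

  inc-new⁻ : ∀ {p l e} → New p e → inc (addPoints S) p l ≡ true → l ∈ᵖ e
  inc-new⁻ {l = l} (np≤p , eq) pl = memPair⁻ l _ (trans (cong (memPair l) (sym eq)) (trans (sym (if-≥ np≤p)) pl))

  inc-new⁺ : ∀ {p l e} → New p e → l ∈ᵖ e → inc (addPoints S) p l ≡ true
  inc-new⁺ {l = l} (np≤p , eq) l∈ = trans (if-≥ np≤p) (trans (cong (memPair l) eq) (memPair⁺ l _ l∈))

-- Uniqueness of joins and meets along a step

record Partial (S : Stage) : Set where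
  field
    unique : ∀ {p q l m} → p < np S → q < np S → l < nl S → m < nl S →
             inc S p l ≡ true → inc S q l ≡ true → inc S p m ≡ true → inc S q m ≡ true →
             p ≡ q ⊎ l ≡ m

partial-dual : ∀ {S} → Partial S → Partial (dual S)
partial-dual ps = record { unique = λ p< q< l< m< pl ql pm qm →
  [ inj₂ , inj₁ ]′ (Partial.unique ps l< m< p< q< pl pm ql qm) }

-- A new point shares no two lines with an old one, since its pair was chosen for not meeting. Two
-- new points that share two lines were added for the same pair, so they are equal.
partial-addPoints : ∀ {S} → Partial S → Partial (addPoints S)
partial-addPoints {S} ps = record { unique = λ {p} {q} {l} {m} p< q< → go (old-or-new S p<) (old-or-new S q<) }
  where
  old-new : ∀ {p q l m e} → p < np S → New S q e → l ≢ m →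
            inc (addPoints S) p l ≡ true → inc (addPoints S) q l ≡ true →
            inc (addPoints S) p m ≡ true → inc (addPoints S) q m ≡ true → ⊥
  old-new {p} {e = a , b} p< qe l≢m pl ql pm qm with a<b , _ , ¬meet ← New-∈ S qe
    with inc-new⁻ S qe ql | inc-new⁻ S qe qm
  ... | inj₁ refl | inj₁ refl = l≢m refl
  ... | inj₂ refl | inj₂ refl = l≢m refl
  ... | inj₁ refl | inj₂ refl
    with () ← trans (sym ¬meet) (meets⁺ S p< (trans (sym (inc-old S p<)) pl) (trans (sym (inc-old S p<)) pm))
  ... | inj₂ refl | inj₁ refl
    with () ← trans (sym ¬meet) (meets⁺ S p< (trans (sym (inc-old S p<)) pm) (trans (sym (inc-old S p<)) pl))

  go : ∀ {p q l m} → p < np S ⊎ ∃ (New S p) → q < np S ⊎ ∃ (New S q) → l < nl S → m < nl S →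
       inc (addPoints S) p l ≡ true → inc (addPoints S) q l ≡ true →
       inc (addPoints S) p m ≡ true → inc (addPoints S) q m ≡ true → p ≡ q ⊎ l ≡ m
  go {l = l} {m} p? q? l< m< pl ql pm qm with l ≟ m
  ... | yes l≡m = inj₂ l≡m
  go (inj₁ p<) (inj₁ q<) l< m< pl ql pm qm | no _ = Partial.unique ps p< q< l< m<
    (trans (sym (inc-old S p<)) pl) (trans (sym (inc-old S q<)) ql)
    (trans (sym (inc-old S p<)) pm) (trans (sym (inc-old S q<)) qm)
  go (inj₁ p<) (inj₂ (_ , qe)) l< m< pl ql pm qm | no l≢m = ⊥-elim (old-new p< qe l≢m pl ql pm qm)
  go (inj₂ (_ , pe)) (inj₁ q<) l< m< pl ql pm qm | no l≢m = ⊥-elim (old-new q< pe l≢m ql pl qm pm)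
  go (inj₂ (_ , pe)) (inj₂ (_ , qe)) l< m< pl ql pm qm | no l≢m = inj₁ (New-unique S pe
    (subst (New S _) (trans (sym (∈ᵖ⇒sortPair (proj₁ (New-∈ S qe)) l≢m (inc-new⁻ S qe ql) (inc-new⁻ S qe qm)))
                            (∈ᵖ⇒sortPair (proj₁ (New-∈ S pe)) l≢m (inc-new⁻ S pe pl) (inc-new⁻ S pe pm))) qe))

meet-addPoints-< : ∀ S {a b} → a < b → b < nl S →
  ∃ λ p → p < np (addPoints S) × inc (addPoints S) p a ≡ true × inc (addPoints S) p b ≡ true
meet-addPoints-< S {a} {b} a<b b< with meets S a b in e
... | true with p , p< , pa , pb ← meets⁻ S e =
  p , ≤-trans p< (m≤m+n _ _) , trans (inc-old S p<) pa , trans (inc-old S p<) pb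
... | false with pe ← ∈⇒New S (∈-newPtPairs⁺ S a<b b< e) =
  _ , New-< S pe , inc-new⁺ S pe (inj₁ refl) , inc-new⁺ S pe (inj₂ refl)

meet-addPoints : ∀ S {a b} → a < nl S → b < nl S → a ≢ b →
  ∃ λ p → p < np (addPoints S) × inc (addPoints S) p a ≡ true × inc (addPoints S) p b ≡ true
meet-addPoints S {a} {b} a< b< a≢b with <-cmp a b
... | tri≈ _ a≡b _ = contradiction a≡b a≢b
... | tri< a<b _ _ = meet-addPoints-< S a<b b<
... | tri> _ _ b<a with p , p< , pb , pa ← meet-addPoints-< S b<a a< = p , p< , pa , pb

-- The cube equations replace an inverse map: the square of `m` inverts `m`, so injectivity and
-- reflection of incidence follow from preservation alone. They also rule out that `m` swaps two
-- elements.
record Auto (S : Stage) (m : Maps) : Set where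
  field
    rangeP : ∀ {p} → p < np S → fp m p < np S
    rangeL : ∀ {l} → l < nl S → fl m l < nl S
    cubeP  : ∀ {p} → p < np S → fp m (fp m (fp m p)) ≡ p
    cubeL  : ∀ {l} → l < nl S → fl m (fl m (fl m l)) ≡ l
    pres   : ∀ {p l} → p < np S → l < nl S → inc S p l ≡ true → inc S (fp m p) (fl m l) ≡ true

  injP : ∀ {p q} → p < np S → q < np S → fp m p ≡ fp m q → p ≡ q
  injP p< q< eq = trans (sym (cubeP p<)) (trans (cong (λ k → fp m (fp m k)) eq) (cubeP q<))

  injL : ∀ {k l} → k < nl S → l < nl S → fl m k ≡ fl m l → k ≡ l
  injL k< l< eq = trans (sym (cubeL k<)) (trans (cong (λ k → fl m (fl m k)) eq) (cubeL l<))

  reflects : ∀ {p l} → p < np S → l < nl S → inc S (fp m p) (fl m l) ≡ true → inc S p l ≡ true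
  reflects p< l< h = subst₂ (λ p l → inc S p l ≡ true) (cubeP p<) (cubeL l<)
    (pres (rangeP (rangeP p<)) (rangeL (rangeL l<)) (pres (rangeP p<) (rangeL l<) h))

  meets-reflects : ∀ {a b} → a < nl S → b < nl S → meets S (fl m a) (fl m b) ≡ true → meets S a b ≡ true
  meets-reflects a< b< h with p , p< , pa , pb ← meets⁻ S h =
    meets⁺ S (rangeP (rangeP p<)) (back p< a< pa) (back p< b< pb)
    where
    back : ∀ {a p} → p < np S → a < nl S → inc S p (fl m a) ≡ true → inc S (fp m (fp m p)) a ≡ true
    back p< a< pa = reflects (rangeP (rangeP p<)) a< (subst (λ q → inc S q _ ≡ true) (sym (cubeP p<)) pa)

auto-dual : ∀ {S m} → Auto S m → Auto (dual S) (dualMaps m)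
auto-dual A = record
  { rangeP = Auto.rangeL A ; rangeL = Auto.rangeP A ; cubeP = Auto.cubeL A ; cubeL = Auto.cubeP A
  ; pres = λ p< l< → Auto.pres A l< p< }

-- The extended map is described by its values, because the local functions `img` of `extPoints` and
-- `extLines` are separate definitions: unlike the stages, the maps are not definitionally dual to
-- each other.
record Extends (S : Stage) (m m′ : Maps) : Set where
  field
    sameL : ∀ l → fl m′ l ≡ fl m l
    oldP  : ∀ {p} → p < np S → fp m′ p ≡ fp m p
    newP  : ∀ {p e} → New S p e → fp m′ p ≡ np S + idx pairEq (image (fl m) e) (newPtPairs S)

extPoints-extends : ∀ S m → Extends S m (extPoints S m)
extPoints-extends S m = record { sameL = λ _ → refl ; oldP = if-< ; newP = new }
  where
  new : ∀ {p e} → New S p e → fp (extPoints S m) p ≡ np S + idx pairEq (image (fl m) e) (newPtPairs S)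
  new (np≤p , eq) rewrite eq = if-≥ np≤p

extLines-extends : ∀ S m → Extends (dual S) (dualMaps m) (dualMaps (extLines S m))
extLines-extends S m = record { sameL = λ _ → refl ; oldP = if-< ; newP = new }
  where
  new : ∀ {p e} → New (dual S) p e →
        fl (extLines S m) p ≡ nl S + idx pairEq (image (fp m) e) (newPtPairs (dual S))
  new (nl≤p , eq) rewrite eq = if-≥ nl≤p

module _ {S : Stage} {m m′ : Maps} (A : Auto S m) (E : Extends S m m′) where
  open Auto A
  open Extends E

  -- Meeting is reflected by `m`, so the image of a pair that does not meet is again in the list of
  -- new pairs. Hence `idx` really finds it and does not return its default, the length of the list.
  New-image : ∀ {p e} → New S p e → New S (fp m′ p) (image (fl m) e)
  New-image {p} {a , b} pe with a<b , b< , ¬meet ← New-∈ S pe =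
    subst (λ q → New S q (image (fl m) (a , b))) (sym (newP pe)) (∈⇒New S image∈)
    where
    a< : a < nl S
    a< = <-trans a<b b<
    ¬meets : ∀ {c d} → c < nl S → d < nl S → meets S c d ≡ false → meets S (fl m c) (fl m d) ≡ false
    ¬meets {c} {d} c< d< ¬cd with meets S (fl m c) (fl m d) in e
    ... | false = refl
    ... | true with () ← trans (sym ¬cd) (meets-reflects c< d< e)
    image∈ : image (fl m) (a , b) ∈ newPtPairs S
    image∈ with <-cmp (fl m a) (fl m b)
    ... | tri< ga<gb _ _ = subst (_∈ newPtPairs S) (sym (sortPair-< ga<gb))
                             (∈-newPtPairs⁺ S ga<gb (rangeL b<) (¬meets a< b< ¬meet))
    ... | tri≈ _ ga≡gb _ = contradiction (injL a< b< ga≡gb) (<⇒≢ a<b)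
    ... | tri> _ _ gb<ga = subst (_∈ newPtPairs S) (sym (sortPair-> gb<ga))
                             (∈-newPtPairs⁺ S gb<ga (rangeL a<) (meets-comm S (¬meets a< b< ¬meet)))

  image-cube : ∀ {p e} → New S p e → image (fl m) (image (fl m) (image (fl m) e)) ≡ e
  image-cube {e = a , b} pe with a<b , b< , _ ← New-∈ S pe =
    trans (cong (image g) (image-sortPair g (g a) (g b)))
      (trans (image-sortPair g (g (g a)) (g (g b)))
        (trans (cong₂ sortPair (cubeL (<-trans a<b b<)) (cubeL b<)) (sortPair-< a<b)))
    where
    g = fl m

  extension-fixes : ∀ {p a b} → New S p (a , b) → fp m′ p ≡ p → fl m a ≡ a × fl m b ≡ b
  extension-fixes {p} {a} {b} pe fix with a<b , b< , _ ← New-∈ S pe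
    with eq ← New-fun S (subst (λ q → New S q _) fix (New-image pe)) pe
    with <-cmp (fl m a) (fl m b)
  ... | tri< lt _ _ with pe≡ ← trans (sym (sortPair-< lt)) eq = ,-injectiveˡ pe≡ , ,-injectiveʳ pe≡
  ... | tri≈ _ ga≡gb _ = contradiction (injL (<-trans a<b b<) b< ga≡gb) (<⇒≢ a<b)
  -- an order-3 map cannot swap a and b
  ... | tri> _ _ gt with pe≡ ← trans (sym (sortPair-> gt)) eq
    with gb≡a ← ,-injectiveˡ pe≡ | ga≡b ← ,-injectiveʳ pe≡ = contradiction
      (trans (sym (cubeL (<-trans a<b b<)))
        (trans (cong (λ k → fl m (fl m k)) ga≡b) (trans (cong (fl m) gb≡a) ga≡b))) (<⇒≢ a<b)

  auto-extension : Auto (addPoints S) m′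
  auto-extension = record
    { rangeP = rangeP′ ; rangeL = λ {l} l< → subst (_< nl S) (sym (sameL l)) (rangeL l<)
    ; cubeP = cubeP′ ; cubeL = λ {l} l< → trans (cong-cube l) (cubeL l<)
    ; pres = λ p< l< → pres′ (old-or-new S p<) l< }
    where
    cong-cube : ∀ l → fl m′ (fl m′ (fl m′ l)) ≡ fl m (fl m (fl m l))
    cong-cube l = trans (sameL _) (cong (fl m) (trans (sameL _) (cong (fl m) (sameL l))))

    rangeP′ : ∀ {p} → p < np (addPoints S) → fp m′ p < np (addPoints S)
    rangeP′ p< with old-or-new S p<
    ... | inj₁ p<np = subst (_< np (addPoints S)) (sym (oldP p<np)) (≤-trans (rangeP p<np) (m≤m+n _ _))
    ... | inj₂ (_ , pe) = New-< S (New-image pe)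

    cubeP′ : ∀ {p} → p < np (addPoints S) → fp m′ (fp m′ (fp m′ p)) ≡ p
    cubeP′ {p} p< with old-or-new S p<
    ... | inj₁ p<np rewrite oldP p<np | oldP (rangeP p<np) | oldP (rangeP (rangeP p<np)) = cubeP p<np
    ... | inj₂ (_ , pe) =
      New-unique S (subst (New S _) (image-cube pe) (New-image (New-image (New-image pe)))) pe

    pres′ : ∀ {p l} → p < np S ⊎ ∃ (New S p) → l < nl S →
            inc (addPoints S) p l ≡ true → inc (addPoints S) (fp m′ p) (fl m′ l) ≡ true
    pres′ {l = l} (inj₁ p<) l< pl rewrite sameL l | oldP p< =
      trans (inc-old S (rangeP p<)) (pres p< l< (trans (sym (inc-old S p<)) pl))
    pres′ {l = l} (inj₂ ((a , b) , pe)) l< pl rewrite sameL l =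
      inc-new⁺ S (New-image pe) (∈ᵖ-sortPair (fl m a) (fl m b) (∈ᵖ-map (inc-new⁻ S pe pl)))
      where
      ∈ᵖ-map : l ∈ᵖ (a , b) → fl m l ∈ᵖ (fl m a , fl m b)
      ∈ᵖ-map (inj₁ refl) = inj₁ refl
      ∈ᵖ-map (inj₂ refl) = inj₂ refl

-- The free completion as an open plane

-- Elements of the union of an increasing chain {0,…,size n - 1}; the stage at which an element
-- is born is unique, so that elements with equal numbers are equal.
module Union (size : ℕ → ℕ) (mono : ∀ {m n} → m ≤ n → size m ≤ size n) where

  lower : ℕ → ℕ
  lower zero    = zero
  lower (suc n) = size n

  record Elem : Set where
    constructor elem
    field
      num   : ℕ
      stage : ℕ
      born  : lower stage ≤ num
      alive : num < size stage
  open Elem public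

  born-after : ∀ {k m n} → k < size m → lower n ≤ k → n ≤ m
  born-after {n = zero}  k< ≤k = z≤n
  born-after {m = m} {n = suc n} k< ≤k with n <? m
  ... | yes n<m = n<m
  ... | no n≮m  = contradiction (≤-trans k< (≤-trans (mono (≮⇒≥ n≮m)) ≤k)) (n≮n _)

  Elem-≡ : ∀ {a b : Elem} → num a ≡ num b → a ≡ b
  Elem-≡ {elem k m b₁ a₁} {elem .k n b₂ a₂} refl with ≤-antisym (born-after a₂ b₁) (born-after a₁ b₂)
  ... | refl with ≤-irrelevant b₁ b₂ | ≤-irrelevant a₁ a₂
  ... | refl | refl = refl

  _≟E_ : DecidableEquality Elem
  a ≟E b = Dec.map′ Elem-≡ (cong num) (num a ≟ num b)

  -- An element present at stage `n` is traced back to the stage of its birth, which `Elem` records.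
  mk : ∀ n {k} → k < size n → Elem
  mk zero    {k} k< = elem k zero z≤n k<
  mk (suc n) {k} k< with k <? size n
  ... | yes k<n = mk n k<n
  ... | no k≮n  = elem k (suc n) (≮⇒≥ k≮n) k<

  num-mk : ∀ n {k} (k< : k < size n) → num (mk n k<) ≡ k
  num-mk zero    k< = refl
  num-mk (suc n) {k} k< with k <? size n
  ... | yes k<n = num-mk n k<n
  ... | no _    = refl

-- What is used of 𝒞₀: `thin` stops the descent of a confined configuration at the initial stage,
-- `thin`, `joins` and `four` make the initial points a quadrangle, and `fixP`, `fixL` start the
-- induction on fixed elements.
record Seed (S : Stage) (m : Maps) (x : ℕ) : Set where
  field
    partial : Partial S
    auto    : Auto S m
    fixP    : ∀ {p} → p < np S → fp m p ≡ p → p ≡ x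
    fixL    : ∀ {l} → l < nl S → fl m l ≢ l
    thin    : ∀ {p q r l} → p < np S → q < np S → r < np S → l < nl S → p ≢ q → p ≢ r → q ≢ r →
              inc S p l ≡ true → inc S q l ≡ true → inc S r l ≡ true → ⊥
    joins   : ∀ {p q} → p < np S → q < np S → p ≢ q →
              ∃ λ l → l < nl S × inc S p l ≡ true × inc S q l ≡ true
    four    : np S ≡ 4
    x<      : x < np S

new-point-on-two-lines : ∀ S {p a b c} → p < np (addPoints S) → a ≢ b → a ≢ c → b ≢ c →
  inc (addPoints S) p a ≡ true → inc (addPoints S) p b ≡ true → inc (addPoints S) p c ≡ true → p < np S
new-point-on-two-lines S p< a≢b a≢c b≢c pa pb pc with old-or-new S p<
... | inj₁ p<np = p<np
... | inj₂ (_ , pe) = ⊥-elim (no-three-in-pair a≢b a≢c b≢c (inc-new⁻ S pe pa) (inc-new⁻ S pe pb) (inc-new⁻ S pe pc))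

three-others : ∀ {x n} → n ≡ 4 → x < n → ∃ λ a → ∃ λ b → ∃ λ c →
  a < n × b < n × c < n × x ≢ a × x ≢ b × x ≢ c × a ≢ b × a ≢ c × b ≢ c
three-others {0} refl _ = 1 , 2 , 3 , s<s (s≤s z≤n) , s<s (s<s (s≤s z≤n)) , ≤-refl ,
  (λ ()) , (λ ()) , (λ ()) , (λ ()) , (λ ()) , (λ ())
three-others {1} refl _ = 0 , 2 , 3 , s≤s z≤n , s<s (s<s (s≤s z≤n)) , ≤-refl ,
  (λ ()) , (λ ()) , (λ ()) , (λ ()) , (λ ()) , (λ ())
three-others {2} refl _ = 0 , 1 , 3 , s≤s z≤n , s<s (s≤s z≤n) , ≤-refl ,
  (λ ()) , (λ ()) , (λ ()) , (λ ()) , (λ ()) , (λ ())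
three-others {3} refl _ = 0 , 1 , 2 , s≤s z≤n , s<s (s≤s z≤n) , s<s (s<s (s≤s z≤n)) ,
  (λ ()) , (λ ()) , (λ ()) , (λ ()) , (λ ()) , (λ ())
three-others {suc (suc (suc (suc x)))} refl (s≤s (s≤s (s≤s (s≤s ()))))

module FreePlane {S₀ : Stage} {m₀ : Maps} {x : ℕ} (seed : Seed S₀ m₀ x) where
  open Seed seed
  open FreeCompletion S₀
  open Extension m₀

  C-even : ∀ n → isEven n ≡ true → C (suc n) ≡ addPoints (C n)
  C-even n e rewrite e = refl

  C-odd : ∀ n → isEven n ≡ false → C (suc n) ≡ addLines (C n)
  C-odd n e rewrite e = refl

  stages : (Q : Stage → Maps → Set) → Q S₀ m₀ →
           (∀ {S m} → Q S m → Q (addPoints S) (extPoints S m)) →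
           (∀ {S m} → Q S m → Q (addLines S) (extLines S m)) →
           ∀ n → Q (C n) (α n)
  stages Q q₀ qP qL zero = q₀
  stages Q q₀ qP qL (suc n) with isEven n
  ... | true  = qP (stages Q q₀ qP qL n)
  ... | false = qL (stages Q q₀ qP qL n)

  partials : ∀ n → Partial (C n)
  partials = stages (λ S _ → Partial S) partial partial-addPoints
    (λ ps → partial-dual (partial-addPoints (partial-dual ps)))

  autos : ∀ n → Auto (C n) (α n)
  autos = stages Auto auto (λ A → auto-extension A (extPoints-extends _ _))
    (λ A → auto-dual (auto-extension (auto-dual A) (extLines-extends _ _)))

  -- Points and lines must be treated together: a fixed new point needs fixed lines, and a fixed new
  -- line needs two different fixed points.
  record FixesOnlyX (S : Stage) (m : Maps) : Set where
    field
      aut     : Auto S m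
      onlyX   : ∀ {p} → p < np S → fp m p ≡ p → p ≡ x
      no-line : ∀ {l} → l < nl S → fl m l ≢ l

  fixes-only-x : ∀ n → FixesOnlyX (C n) (α n)
  fixes-only-x = stages FixesOnlyX (record { aut = auto ; onlyX = fixP ; no-line = fixL }) addP addL
    where
    addP : ∀ {S m} → FixesOnlyX S m → FixesOnlyX (addPoints S) (extPoints S m)
    addP {S} {m} F = record
      { aut = auto-extension aut (extPoints-extends S m) ; onlyX = only ; no-line = no-line }
      where
      open FixesOnlyX F
      only : ∀ {p} → p < np (addPoints S) → fp (extPoints S m) p ≡ p → p ≡ x
      only p< fix with old-or-new S p<
      ... | inj₁ p<np = onlyX p<np (trans (sym (if-< p<np)) fix)
      ... | inj₂ ((a , b) , pe) with a<b , b< , _ ← New-∈ S pe =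
        contradiction (proj₂ (extension-fixes aut (extPoints-extends S m) pe fix)) (no-line b<)
    addL : ∀ {S m} → FixesOnlyX S m → FixesOnlyX (addLines S) (extLines S m)
    addL {S} {m} F = record
      { aut = auto-dual (auto-extension (auto-dual aut) (extLines-extends S m)) ; onlyX = onlyX ; no-line = none }
      where
      open FixesOnlyX F
      none : ∀ {l} → l < nl (addLines S) → fl (extLines S m) l ≢ l
      none l< fix with old-or-new (dual S) l<
      ... | inj₁ l<nl = no-line l<nl (trans (sym (if-< l<nl)) fix)
      ... | inj₂ ((a , b) , le) with a<b , b< , _ ← New-∈ (dual S) le
        with fa , fb ← extension-fixes (auto-dual aut) (extLines-extends S m) le fix =
        <⇒≢ a<b (trans (onlyX (<-trans a<b b<) fa) (sym (onlyX b< fb)))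

  record Extension≤ (S : Stage) (m : Maps) (T : Stage) (m′ : Maps) : Set where
    field
      np≤   : np S ≤ np T
      nl≤   : nl S ≤ nl T
      inc≡  : ∀ {p l} → p < np S → l < nl S → inc T p l ≡ inc S p l
      fp≡   : ∀ {p} → p < np S → fp m′ p ≡ fp m p
      fl≡   : ∀ {l} → l < nl S → fl m′ l ≡ fl m l

  _⊑_ : ℕ → ℕ → Set
  i ⊑ j = Extension≤ (C i) (α i) (C j) (α j)

  ⊑-step : ∀ n → n ⊑ suc n
  ⊑-step n with isEven n
  ... | true  = record
    { np≤ = m≤m+n _ _ ; nl≤ = ≤-refl ; inc≡ = λ p< _ → if-< p< ; fp≡ = λ p< → if-< p< ; fl≡ = λ _ → refl }
  ... | false = record
    { np≤ = ≤-refl ; nl≤ = m≤m+n _ _ ; inc≡ = λ _ l< → if-< l< ; fp≡ = λ _ → refl ; fl≡ = λ l< → if-< l< }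

  ≤⇒⊑ : ∀ {i j} → i ≤ j → i ⊑ j
  ≤⇒⊑ i≤j = go (≤⇒≤′ i≤j)
    where
    go : ∀ {i j} → i ≤′ j → i ⊑ j
    go ≤′-refl = record { np≤ = ≤-refl ; nl≤ = ≤-refl ; inc≡ = λ _ _ → refl ; fp≡ = λ _ → refl ; fl≡ = λ _ → refl }
    go {i} (≤′-step {j} i≤j) = record
      { np≤ = ≤-trans (np≤ f) (np≤ s)
      ; nl≤ = ≤-trans (nl≤ f) (nl≤ s)
      ; inc≡ = λ p< l< → trans (inc≡ s (≤-trans p< (np≤ f)) (≤-trans l< (nl≤ f))) (inc≡ f p< l<)
      ; fp≡ = λ p< → trans (fp≡ s (≤-trans p< (np≤ f))) (fp≡ f p<)
      ; fl≡ = λ l< → trans (fl≡ s (≤-trans l< (nl≤ f))) (fl≡ f l<) }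
      where
      open Extension≤
      f = go i≤j
      s = ⊑-step j

  np-mono : ∀ {i j} → i ≤ j → np (C i) ≤ np (C j)
  np-mono i≤j = Extension≤.np≤ (≤⇒⊑ i≤j)

  nl-mono : ∀ {i j} → i ≤ j → nl (C i) ≤ nl (C j)
  nl-mono i≤j = Extension≤.nl≤ (≤⇒⊑ i≤j)

  fp-stable : ∀ i j {p} → p < np (C i) → p < np (C j) → fp (α i) p ≡ fp (α j) p
  fp-stable i j pi pj = trans (sym (Extension≤.fp≡ (≤⇒⊑ (m≤m⊔n i j)) pi)) (Extension≤.fp≡ (≤⇒⊑ (m≤n⊔m i j)) pj)

  fl-stable : ∀ i j {l} → l < nl (C i) → l < nl (C j) → fl (α i) l ≡ fl (α j) l
  fl-stable i j li lj = trans (sym (Extension≤.fl≡ (≤⇒⊑ (m≤m⊔n i j)) li)) (Extension≤.fl≡ (≤⇒⊑ (m≤n⊔m i j)) lj)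

  inc-at : ∀ n {k l} → k < np (C n) → l < nl (C n) → Inc k l → inc (C n) k l ≡ true
  inc-at n k< l< (i , ki , li , h) =
    trans (sym (Extension≤.inc≡ (≤⇒⊑ (m≤m⊔n n i)) k< l<)) (trans (Extension≤.inc≡ (≤⇒⊑ (m≤n⊔m n i)) ki li) h)

  module Pt = Union (np ∘ C) np-mono
  module Ln = Union (nl ∘ C) nl-mono
  open Pt using () renaming (Elem to Point; num to numP)
  open Ln using () renaming (Elem to Line; num to numL)

  isPt : ∀ p → IsPt (numP p)
  isPt p = Pt.stage p , Pt.alive p

  isLn : ∀ l → IsLn (numL l)
  isLn l = Ln.stage l , Ln.alive l

  aliveP : ∀ (p : Point) {n} → Pt.stage p ≤ n → numP p < np (C n)
  aliveP p ≤n = ≤-trans (Pt.alive p) (np-mono ≤n)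

  aliveL : ∀ (l : Line) {n} → Ln.stage l ≤ n → numL l < nl (C n)
  aliveL l ≤n = ≤-trans (Ln.alive l) (nl-mono ≤n)

  Incident : Point → Line → Set
  Incident p l = Inc (numP p) (numL l)

  -- `Inc` quantifies over all stages, but any one stage that contains both elements decides it.
  incident? : ∀ p l → Dec (Incident p l)
  incident? p l = Dec.map′ (λ h → n , p< , l< , h) (inc-at n p< l<) (inc (C n) (numP p) (numL l) Bool.≟ true)
    where
    n = Pt.stage p ⊔ Ln.stage l
    p< : numP p < np (C n)
    p< = aliveP p (m≤m⊔n _ _)
    l< : numL l < nl (C n)
    l< = aliveL l (m≤n⊔m (Pt.stage p) _)

  incident-unique : ∀ {p q l m} → Incident p l → Incident q l → Incident p m → Incident q m → p ≡ q ⊎ l ≡ m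
  incident-unique {p} {q} {l} {m} pl ql pm qm =
    [ inj₁ ∘ Pt.Elem-≡ , inj₂ ∘ Ln.Elem-≡ ]′
      (Partial.unique (partials n) p< q< l< m< (inc-at n p< l< pl) (inc-at n q< l< ql)
        (inc-at n p< m< pm) (inc-at n q< m< qm))
    where
    n = (Pt.stage p ⊔ Pt.stage q) ⊔ (Ln.stage l ⊔ Ln.stage m)
    p< : numP p < np (C n)
    p< = aliveP p (≤-trans (m≤m⊔n _ _) (m≤m⊔n _ _))
    q< : numP q < np (C n)
    q< = aliveP q (≤-trans (m≤n⊔m (Pt.stage p) _) (m≤m⊔n _ _))
    l< : numL l < nl (C n)
    l< = aliveL l (≤-trans (m≤m⊔n _ _) (m≤n⊔m (Pt.stage p ⊔ Pt.stage q) _))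
    m< : numL m < nl (C n)
    m< = aliveL m (≤-trans (m≤n⊔m (Ln.stage l) _) (m≤n⊔m (Pt.stage p ⊔ Pt.stage q) _))

  -- Points are added in the step out of an even stage and lines in the step out of an odd one. Both
  -- parities recur beyond any stage, so any two given elements are eventually handled together.
  next-even : ∀ n → ∃ λ k → n ≤ k × isEven k ≡ true
  next-even n with isEven n in e
  ... | true  = n , ≤-refl , e
  ... | false = suc n , n≤1+n n , cong not e

  next-odd : ∀ n → ∃ λ k → n ≤ k × isEven k ≡ false
  next-odd n with isEven n in e
  ... | false = n , ≤-refl , e
  ... | true  = suc n , n≤1+n n , cong not e

  incident-join : ∀ {p q} → p ≢ q → ∃ λ l → Incident p l × Incident q l
  incident-join {p} {q} p≢q
    with k , n≤k , odd ← next-odd (Pt.stage p ⊔ Pt.stage q)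
    with p< ← aliveP p (≤-trans (m≤m⊔n _ _) n≤k)
       | q< ← aliveP q (≤-trans (m≤n⊔m (Pt.stage p) _) n≤k)
    with l , l< , lp , lq ← meet-addPoints (dual (C k)) p< q< (p≢q ∘ Pt.Elem-≡)
    = Ln.mk (suc k) l<′ , at p< lp , at q< lq
    where
    l<′ : l < nl (C (suc k))
    l<′ = subst (λ S → l < nl S) (sym (C-odd k odd)) l<
    at : ∀ {r} → r < np (C k) → inc (addLines (C k)) r l ≡ true → Inc r (numL (Ln.mk (suc k) l<′))
    at {r} r< h = subst (Inc r) (sym (Ln.num-mk (suc k) l<′))
      (suc k , ≤-trans r< (np-mono (n≤1+n k)) , l<′ , subst (λ S → inc S r l ≡ true) (sym (C-odd k odd)) h)

  incident-meet : ∀ {l m} → l ≢ m → ∃ λ p → Incident p l × Incident p m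
  incident-meet {l} {m} l≢m
    with k , n≤k , even ← next-even (Ln.stage l ⊔ Ln.stage m)
    with l< ← aliveL l (≤-trans (m≤m⊔n _ _) n≤k)
       | m< ← aliveL m (≤-trans (m≤n⊔m (Ln.stage l) _) n≤k)
    with p , p< , pl , pm ← meet-addPoints (C k) l< m< (l≢m ∘ Ln.Elem-≡)
    = Pt.mk (suc k) p<′ , at l< pl , at m< pm
    where
    p<′ : p < np (C (suc k))
    p<′ = subst (λ S → p < np S) (sym (C-even k even)) p<
    at : ∀ {r} → r < nl (C k) → inc (addPoints (C k)) p r ≡ true → Inc (numP (Pt.mk (suc k) p<′)) r
    at {r} r< h = subst (λ q → Inc q r) (sym (Pt.num-mk (suc k) p<′))
      (suc k , p<′ , ≤-trans r< (nl-mono (n≤1+n k)) , subst (λ S → inc S p r ≡ true) (sym (C-even k even)) h)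

  plane : Plane
  plane = record
    { P = Point ; L = Line ; I = Incident ; _≟L_ = Ln._≟E_ ; I? = incident?
    ; unique = λ {p} {q} {l} {m} → incident-unique {p} {q} {l} {m}
    ; join = incident-join ; meet = incident-meet }
  open Plane plane using (Confined; Open; Noncollinear)

  -- Openness of the free completion

  bounded : {E : Set} (stage : E → ℕ) (xs : List E) → ∃ λ n → All (λ e → stage e ≤ n) xs
  bounded stage [] = 0 , []
  bounded stage (e ∷ xs) with n , all ← bounded stage xs =
    stage e ⊔ n , m≤m⊔n _ _ ∷ All.map (λ ≤n → ≤-trans ≤n (m≤n⊔m (stage e) n)) all

  Within : ℕ → List Point → List Line → Set
  Within n ps ls = All (λ p → numP p < np (C n)) ps × All (λ l → numL l < nl (C n)) ls

  -- An element of the last stage met by a confined configuration would be incident with at most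
  -- two of its elements.
  within-previous : ∀ n {ps ls} → Confined ps ls → Within (suc n) ps ls → Within n ps ls
  within-previous n {ps} {ls} (points , lines) (ps< , ls<) = by-parity (isEven n) refl
    where
    by-parity : ∀ b → isEven n ≡ b → Within n ps ls
    by-parity true e = All.tabulate old , All.map (λ {l} → subst (λ S → numL l < nl S) (C-even n e)) ls<
      where
      old : ∀ {q} → q ∈ ps → numP q < np (C n)
      old {q} q∈ with All.lookup points q∈
      ... | triple {a} {b} {c} a≢b a≢c b≢c a∈ b∈ c∈ qa qb qc =
        new-point-on-two-lines (C n) (subst (λ S → numP q < np S) (C-even n e) (All.lookup ps< q∈))
          (a≢b ∘ Ln.Elem-≡) (a≢c ∘ Ln.Elem-≡) (b≢c ∘ Ln.Elem-≡) (at a∈ qa) (at b∈ qb) (at c∈ qc)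
        where
        at : ∀ {l} → l ∈ ls → Incident q l → inc (addPoints (C n)) (numP q) (numL l) ≡ true
        at {l} l∈ ql = subst (λ S → inc S (numP q) (numL l) ≡ true) (C-even n e)
          (inc-at (suc n) (All.lookup ps< q∈) (All.lookup ls< l∈) ql)
    by-parity false e = All.map (λ {p} → subst (λ S → numP p < np S) (C-odd n e)) ps< , All.tabulate old
      where
      old : ∀ {l} → l ∈ ls → numL l < nl (C n)
      old {l} l∈ with All.lookup lines l∈
      ... | triple {a} {b} {c} a≢b a≢c b≢c a∈ b∈ c∈ al bl cl =
        new-point-on-two-lines (dual (C n)) (subst (λ S → numL l < nl S) (C-odd n e) (All.lookup ls< l∈))
          (a≢b ∘ Pt.Elem-≡) (a≢c ∘ Pt.Elem-≡) (b≢c ∘ Pt.Elem-≡) (at a∈ al) (at b∈ bl) (at c∈ cl)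
        where
        at : ∀ {q} → q ∈ ps → Incident q l → inc (addLines (C n)) (numP q) (numL l) ≡ true
        at {q} q∈ ql = subst (λ S → inc S (numP q) (numL l) ≡ true) (C-odd n e)
          (inc-at (suc n) (All.lookup ps< q∈) (All.lookup ls< l∈) ql)

  -- The configuration survives down to the initial stage. There its first point supplies a line,
  -- and that line would carry three initial points, against `thin`.
  descend : ∀ n {p ps ls} → Confined (p ∷ ps) ls → Within n (p ∷ ps) ls → ⊥
  descend zero (triple _ _ _ l∈ _ _ _ _ _ ∷ _ , lines) (ps< , ls<) with All.lookup lines l∈
  ... | triple a≢b a≢c b≢c a∈ b∈ c∈ al bl cl =
    thin a< b< c< l< (a≢b ∘ Pt.Elem-≡) (a≢c ∘ Pt.Elem-≡) (b≢c ∘ Pt.Elem-≡)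
      (inc-at 0 a< l< al) (inc-at 0 b< l< bl) (inc-at 0 c< l< cl)
    where
    a< = All.lookup ps< a∈
    b< = All.lookup ps< b∈
    c< = All.lookup ps< c∈
    l< = All.lookup ls< l∈
  descend (suc n) conf within = descend n conf (within-previous n conf within)

  open-plane : Open
  open-plane p ps ls conf with bounded Pt.stage (p ∷ ps) | bounded Ln.stage ls
  ... | i , ps≤ | j , ls≤ = descend (i ⊔ j) conf
    ( All.map (λ {q} ≤i → aliveP q (≤-trans ≤i (m≤m⊔n i j))) ps≤
    , All.map (λ {l} ≤j → aliveL l (≤-trans ≤j (m≤n⊔m i j))) ls≤ )

  seed-point : ∀ {k} → k < np S₀ → Point
  seed-point k< = Pt.mk 0 k<

  -- A line of the completion through two initial points can only be the initial line that joins
  -- them, and that one has no third initial point.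
  noncollinear : ∀ {a b c} (a< : a < np S₀) (b< : b < np S₀) (c< : c < np S₀) → a ≢ b → a ≢ c → b ≢ c →
    Noncollinear (seed-point a<) (seed-point b<) (seed-point c<)
  noncollinear a< b< c< a≢b a≢c b≢c {l} al bl cl with k , k< , ak , bk ← joins a< b< a≢b
    with incident-unique {seed-point a<} {seed-point b<} {l} {Ln.mk 0 k<} al bl (0 , a< , k< , ak) (0 , b< , k< , bk)
  ... | inj₁ eq = a≢b (cong numP eq)
  ... | inj₂ refl = thin a< b< c< k< a≢b a≢c b≢c ak bk (inc-at 0 c< k< cl)

  x-point : Point
  x-point = seed-point x<

  quadrangle : ∃ λ (Q : Quadrangle plane) → Quadrangle.x Q ≡ x-point
  quadrangle with a , b , c , a< , b< , c< , x≢a , x≢b , x≢c , a≢b , a≢c , b≢c ← three-others four x< =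
    record
      { x = x-point ; a = seed-point a< ; b = seed-point b< ; c = seed-point c<
      ; x≢a = x≢a ∘ cong numP ; x≢b = x≢b ∘ cong numP ; x≢c = x≢c ∘ cong numP
      ; a≢b = a≢b ∘ cong numP ; a≢c = a≢c ∘ cong numP ; b≢c = b≢c ∘ cong numP
      ; xab = λ {l} → noncollinear x< a< b< x≢a x≢b a≢b {l}
      ; xac = λ {l} → noncollinear x< a< c< x≢a x≢c a≢c {l}
      ; xbc = λ {l} → noncollinear x< b< c< x≢b x≢c b≢c {l}
      ; abc = λ {l} → noncollinear a< b< c< a≢b a≢c b≢c {l} }
    , refl

  rich-pencil-x : RichPencil plane x-point
  rich-pencil-x with Q , eq ← quadrangle = subst (RichPencil plane) eq (DiagonalPoints.rich-pencil plane Q open-plane)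

  -- The value is taken at the birth stage of `p`; by stability of the extensions every later stage
  -- gives the same number.
  ᾱP : Point → Point
  ᾱP p = Pt.mk (Pt.stage p) (Auto.rangeP (autos (Pt.stage p)) (Pt.alive p))

  ᾱLine : Line → Line
  ᾱLine l = Ln.mk (Ln.stage l) (Auto.rangeL (autos (Ln.stage l)) (Ln.alive l))

  num-ᾱP : ∀ p n → numP p < np (C n) → numP (ᾱP p) ≡ fp (α n) (numP p)
  num-ᾱP p n p< = trans (Pt.num-mk (Pt.stage p) _) (fp-stable (Pt.stage p) n (Pt.alive p) p<)

  num-ᾱLine : ∀ l n → numL l < nl (C n) → numL (ᾱLine l) ≡ fl (α n) (numL l)
  num-ᾱLine l n l< = trans (Ln.num-mk (Ln.stage l) _) (fl-stable (Ln.stage l) n (Ln.alive l) l<)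

  ᾱ : Collineation plane
  ᾱ = record
    { onP = ᾱP ; onL = ᾱLine
    ; inj-onP = inj-P ; inj-onL = inj-L
    ; pres = λ {p} {l} → pres-I p l ; reflects = λ {p} {l} → refl-I p l }
    where
    inj-P : ∀ {p q} → ᾱP p ≡ ᾱP q → p ≡ q
    inj-P {p} {q} eq = Pt.Elem-≡ (Auto.injP (autos n) p< q<
      (trans (sym (num-ᾱP p n p<)) (trans (cong numP eq) (num-ᾱP q n q<))))
      where
      n = Pt.stage p ⊔ Pt.stage q
      p< : numP p < np (C n)
      p< = aliveP p (m≤m⊔n _ _)
      q< : numP q < np (C n)
      q< = aliveP q (m≤n⊔m (Pt.stage p) _)
    inj-L : ∀ {k l} → ᾱLine k ≡ ᾱLine l → k ≡ l
    inj-L {k} {l} eq = Ln.Elem-≡ (Auto.injL (autos n) k< l<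
      (trans (sym (num-ᾱLine k n k<)) (trans (cong numL eq) (num-ᾱLine l n l<))))
      where
      n = Ln.stage k ⊔ Ln.stage l
      k< : numL k < nl (C n)
      k< = aliveL k (m≤m⊔n _ _)
      l< : numL l < nl (C n)
      l< = aliveL l (m≤n⊔m (Ln.stage k) _)
    pres-I : ∀ p l → Incident p l → Incident (ᾱP p) (ᾱLine l)
    pres-I p l (n , p< , l< , h) =
      subst₂ Inc (sym (num-ᾱP p n p<)) (sym (num-ᾱLine l n l<))
        (n , Auto.rangeP (autos n) p< , Auto.rangeL (autos n) l< , Auto.pres (autos n) p< l< h)
    refl-I : ∀ p l → Incident (ᾱP p) (ᾱLine l) → Incident p l
    refl-I p l h = n , p< , l< , Auto.reflects (autos n) p< l<
      (inc-at n (Auto.rangeP (autos n) p<) (Auto.rangeL (autos n) l<)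
        (subst₂ Inc (num-ᾱP p n p<) (num-ᾱLine l n l<) h))
      where
      n = Pt.stage p ⊔ Ln.stage l
      p< : numP p < np (C n)
      p< = aliveP p (m≤m⊔n _ _)
      l< : numL l < nl (C n)
      l< = aliveL l (m≤n⊔m (Pt.stage p) _)

  -- Comparison with an automorphism

  module _ {f g : ℕ → ℕ} (γ : IsAut f g) where
    open IsAut γ

    -- `f` and `g` act on bare numbers and are controlled only on actual elements, so the inverse is
    -- read off from the witnesses of surjectivity there.
    γ⁻¹P : Point → Point
    γ⁻¹P p with k , (n , k<) , _ ← surjP (numP p) (isPt p) = Pt.mk n k<

    γ⁻¹L : Line → Line
    γ⁻¹L l with k , (n , k<) , _ ← surjL (numL l) (isLn l) = Ln.mk n k<

    f-γ⁻¹P : ∀ p → f (numP (γ⁻¹P p)) ≡ numP p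
    f-γ⁻¹P p with k , (n , k<) , eq ← surjP (numP p) (isPt p) = trans (cong f (Pt.num-mk n k<)) eq

    g-γ⁻¹L : ∀ l → g (numL (γ⁻¹L l)) ≡ numL l
    g-γ⁻¹L l with k , (n , k<) , eq ← surjL (numL l) (isLn l) = trans (cong g (Ln.num-mk n k<)) eq

    γ⁻¹ᾱ : Collineation plane
    γ⁻¹ᾱ = record
      { onP = γ⁻¹P ∘ ᾱP ; onL = γ⁻¹L ∘ ᾱLine
      ; inj-onP = λ {p} {q} eq → Collineation.inj-onP ᾱ (Pt.Elem-≡
          (trans (sym (f-γ⁻¹P (ᾱP p))) (trans (cong (f ∘ numP) eq) (f-γ⁻¹P (ᾱP q)))))
      ; inj-onL = λ {k} {l} eq → Collineation.inj-onL ᾱ (Ln.Elem-≡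
          (trans (sym (g-γ⁻¹L (ᾱLine k))) (trans (cong (g ∘ numL) eq) (g-γ⁻¹L (ᾱLine l)))))
      ; pres = λ {p} {l} h → Equivalence.from (presI _ _ (isPt (γ⁻¹P (ᾱP p))) (isLn (γ⁻¹L (ᾱLine l))))
          (subst₂ Inc (sym (f-γ⁻¹P (ᾱP p))) (sym (g-γ⁻¹L (ᾱLine l))) (Collineation.pres ᾱ {p} {l} h))
      ; reflects = λ {p} {l} h → Collineation.reflects ᾱ {p} {l}
          (subst₂ Inc (f-γ⁻¹P (ᾱP p)) (g-γ⁻¹L (ᾱLine l))
            (Equivalence.to (presI _ _ (isPt (γ⁻¹P (ᾱP p))) (isLn (γ⁻¹L (ᾱLine l)))) h)) }

    -- Together with its converse `fixes⇒agree`: the composite fixes a line exactly when both maps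
    -- agree on it. This direction serves the lines through `x`, the converse serves `U`.
    γ⁻¹ᾱ-fixes : ∀ l → numL (ᾱLine l) ≡ g (numL l) → γ⁻¹L (ᾱLine l) ≡ l
    γ⁻¹ᾱ-fixes l eq = Ln.Elem-≡ (injL _ _ (isLn (γ⁻¹L (ᾱLine l))) (isLn l) (trans (g-γ⁻¹L (ᾱLine l)) eq))

    fixes⇒agree : ∀ l → γ⁻¹L (ᾱLine l) ≡ l → numL (ᾱLine l) ≡ g (numL l)
    fixes⇒agree l eq = trans (sym (g-γ⁻¹L (ᾱLine l))) (cong (g ∘ numL) eq)

    -- γ⁻¹ᾱ is central with centre x, hence fixes U; so ᾱ fixes U as γ does.
    no-fixed-line : ∀ {U} → IsLn U → ¬ Inc x U → g U ≡ U → ¬ (∀ L → IsLn L → Inc x L → ᾱL L (g L))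
    no-fixed-line {U} (n , U<) x∉U gU≡U agree =
      FixesOnlyX.no-line (fixes-only-x (Ln.stage u)) (Ln.alive u)
        (trans (sym (num-ᾱLine u (Ln.stage u) (Ln.alive u)))
          (trans (fixes⇒agree u (CentralCollineation.fixes-lines plane x-point rich-pencil-x open-plane γ⁻¹ᾱ
             (λ {l} → central {l}) {u} (x∉U ∘ subst (Inc x) num-u)))
            (trans (cong g num-u) (trans gU≡U (sym num-u)))))
      where
      u = Ln.mk n U<
      num-u : numL u ≡ U
      num-u = Ln.num-mk n U<
      central : ∀ {l} → Incident x-point l → γ⁻¹L (ᾱLine l) ≡ l
      central {l} x∈l with k , l< , eq ← agree (numL l) (isLn l) x∈l =
        γ⁻¹ᾱ-fixes l (trans (num-ᾱLine l k l<) eq)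

  -- Any initial line through `x` will do, since no initial line is fixed.
  moves-line-through-x : ∃ λ L → IsLn L × Inc x L × ∃ λ L′ → ᾱL L L′ × L′ ≢ L
  moves-line-through-x with a , _ , _ , a< , _ , _ , x≢a , _ ← three-others four x<
    with l , l< , xl , _ ← joins x< a< x≢a =
    l , (0 , l<) , (0 , x< , l< , xl) , fl m₀ l , (0 , l< , refl) , fixL l<

-- The punctured Fano plane

finEq-decides : DecidesEq finEq
finEq-decides = record
  { sound    = λ {a} {b} t → toℕ-injective (≡ᵇ⇒≡ (toℕ a) (toℕ b) t)
  ; complete = λ a → ≡⇒≡ᵇ (toℕ a) (toℕ a) refl }

-- The properties of 𝒞₀ that do not involve α are finite and are settled by evaluation for all seven
-- lines `M`. The bounds are interleaved with the variables because `allUpTo?` decides statements of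
-- that shape.
partial? : ∀ S → Dec (∀ {p} → p < np S → ∀ {q} → q < np S → ∀ {l} → l < nl S → ∀ {m} → m < nl S →
  inc S p l ≡ true → inc S q l ≡ true → inc S p m ≡ true → inc S q m ≡ true → p ≡ q ⊎ l ≡ m)
partial? S = allUpTo? (λ p → allUpTo? (λ q → allUpTo? (λ l → allUpTo? (λ m →
  (inc S p l Bool.≟ true) →-dec ((inc S q l Bool.≟ true) →-dec ((inc S p m Bool.≟ true) →-dec
  ((inc S q m Bool.≟ true) →-dec ((p ≟ q) ⊎-dec (l ≟ m)))))) (nl S)) (nl S)) (np S)) (np S)

C₀-unique : ∀ M {p} → p < np (C₀ M) → ∀ {q} → q < np (C₀ M) → ∀ {l} → l < nl (C₀ M) → ∀ {m} → m < nl (C₀ M) →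
  inc (C₀ M) p l ≡ true → inc (C₀ M) q l ≡ true → inc (C₀ M) p m ≡ true → inc (C₀ M) q m ≡ true →
  p ≡ q ⊎ l ≡ m
C₀-unique = toWitness {a? = all? (λ M → partial? (C₀ M))} _

thin? : ∀ S → Dec (∀ {p} → p < np S → ∀ {q} → q < np S → ∀ {r} → r < np S → ∀ {l} → l < nl S →
  inc S p l ≡ true → inc S q l ≡ true → inc S r l ≡ true → p ≡ q ⊎ p ≡ r ⊎ q ≡ r)
thin? S = allUpTo? (λ p → allUpTo? (λ q → allUpTo? (λ r → allUpTo? (λ l →
  (inc S p l Bool.≟ true) →-dec ((inc S q l Bool.≟ true) →-dec ((inc S r l Bool.≟ true) →-dec
  ((p ≟ q) ⊎-dec ((p ≟ r) ⊎-dec (q ≟ r)))))) (nl S)) (np S)) (np S)) (np S)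

C₀-thin : ∀ M {p} → p < np (C₀ M) → ∀ {q} → q < np (C₀ M) → ∀ {r} → r < np (C₀ M) → ∀ {l} → l < nl (C₀ M) →
  inc (C₀ M) p l ≡ true → inc (C₀ M) q l ≡ true → inc (C₀ M) r l ≡ true → p ≡ q ⊎ p ≡ r ⊎ q ≡ r
C₀-thin = toWitness {a? = all? (λ M → thin? (C₀ M))} _

joins? : ∀ S → Dec (∀ {p} → p < np S → ∀ {q} → q < np S → p ≢ q →
  ∃ λ l → l < nl S × inc S p l ≡ true × inc S q l ≡ true)
joins? S = allUpTo? (λ p → allUpTo? (λ q → ¬? (p ≟ q) →-dec
  anyUpTo? (λ l → (inc S p l Bool.≟ true) ×-dec (inc S q l Bool.≟ true)) (nl S)) (np S)) (np S)

C₀-joins : ∀ M {p} → p < np (C₀ M) → ∀ {q} → q < np (C₀ M) → p ≢ q →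
  ∃ λ l → l < nl (C₀ M) × inc (C₀ M) p l ≡ true × inc (C₀ M) q l ≡ true
C₀-joins = toWitness {a? = all? (λ M → joins? (C₀ M))} _

C₀-four : ∀ M → np (C₀ M) ≡ 4
C₀-four = toWitness {a? = all? (λ M → np (C₀ M) ≟ 4)} _

incC₀-nth : ∀ M {i j p l} → nth (ptsC₀ M) i ≡ just p → nth (lnsC₀ M) j ≡ just l → incC₀ M i j ≡ IncF p l
incC₀-nth M ei ej rewrite ei | ej = refl

-- `applyF` acts on positions in `xs`. Closure under `a` guarantees that `idx` finds the image, so
-- that its default value never occurs at a valid position.
module Restrict (a : Fin 7 → Fin 7) (xs : List (Fin 7)) (xs! : Unique xs)
                (closed : ∀ {p} → p ∈ xs → a p ∈ xs) where

  nth-applyF : ∀ {i p} → nth xs i ≡ just p → nth xs (applyF a xs i) ≡ just (a p)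
  nth-applyF {i} eq rewrite eq = nth-idx finEq-decides (closed (nth-∈ xs i eq))

  range : ∀ {i} → i < length xs → applyF a xs i < length xs
  range {i} i< with p , eq ← <⇒nth xs i< = nth⇒< xs _ (nth-applyF eq)

  cube : (∀ p → a (a (a p)) ≡ p) → ∀ {i} → i < length xs → applyF a xs (applyF a xs (applyF a xs i)) ≡ i
  cube a³ {i} i< with p , eq ← <⇒nth xs i< =
    nth-injective xs! _ _ (nth-applyF {applyF a xs (applyF a xs i)} (nth-applyF {applyF a xs i} (nth-applyF {i} eq)))
      (trans eq (cong just (sym (a³ p))))

  fixed : ∀ {i p} → nth xs i ≡ just p → applyF a xs i ≡ i → a p ≡ p
  fixed eq fix = just-injective (trans (sym (nth-applyF eq)) (trans (cong (nth xs) fix) eq))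

off? : ∀ M p → Dec (T (not (IncF p M)))
off? M p = Bool.T? (not (IncF p M))

otherThan? : ∀ M l → Dec (T (not (finEq l M)))
otherThan? M l = Bool.T? (not (finEq l M))

ptsC₀! : ∀ M → Unique (ptsC₀ M)
ptsC₀! M = Unique.filter⁺ (off? M) (Unique.allFin⁺ 7)

lnsC₀! : ∀ M → Unique (lnsC₀ M)
lnsC₀! M = Unique.filter⁺ (otherThan? M) (Unique.allFin⁺ 7)

∈-ptsC₀⁺ : ∀ M {p} → IncF p M ≡ false → p ∈ ptsC₀ M
∈-ptsC₀⁺ M {p} p∉M = ∈-filter⁺ (off? M) (∈-allFin p) (Equivalence.from T-not-≡ p∉M)

∈-ptsC₀⁻ : ∀ M {p} → p ∈ ptsC₀ M → IncF p M ≡ false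
∈-ptsC₀⁻ M p∈ = Equivalence.to T-not-≡ (proj₂ (∈-filter⁻ (off? M) {xs = allFin 7} p∈))

∈-lnsC₀⁺ : ∀ M {l} → l ≢ M → l ∈ lnsC₀ M
∈-lnsC₀⁺ M {l} l≢M with finEq l M in e
... | true  = contradiction (DecidesEq.sound finEq-decides (Equivalence.from T-≡ e)) l≢M
... | false = ∈-filter⁺ (otherThan? M) (∈-allFin l) (Equivalence.from T-not-≡ e)

∈-lnsC₀⁻ : ∀ M {l} → l ∈ lnsC₀ M → l ≢ M
∈-lnsC₀⁻ M l∈ refl with () ← trans (sym (Equivalence.to T-≡ (DecidesEq.complete finEq-decides M)))
                                  (Equivalence.to T-not-≡ (proj₂ (∈-filter⁻ (otherThan? M) {xs = allFin 7} l∈)))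

module FanoSeed {x M : Fin 7} (x∉M : IncF x M ≡ false) {aP aL : Fin 7 → Fin 7}
  (pres : ∀ p l → IncF (aP p) (aL l) ≡ IncF p l)
  (aP³ : ∀ p → aP (aP (aP p)) ≡ p) (aL³ : ∀ l → aL (aL (aL l)) ≡ l)
  (aM : aL M ≡ M)
  (only-x : ∀ p → aP p ≡ p → p ≡ x) (only-M : ∀ l → aL l ≡ l → l ≡ M) where

  closedP : ∀ {p} → p ∈ ptsC₀ M → aP p ∈ ptsC₀ M
  closedP {p} p∈ = ∈-ptsC₀⁺ M (trans (cong (IncF (aP p)) (sym aM)) (trans (pres p M) (∈-ptsC₀⁻ M p∈)))

  closedL : ∀ {l} → l ∈ lnsC₀ M → aL l ∈ lnsC₀ M
  closedL {l} l∈ = ∈-lnsC₀⁺ M λ al≡M → ∈-lnsC₀⁻ M l∈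
    (trans (sym (aL³ l)) (trans (cong (aL ∘ aL) al≡M) (trans (cong aL aM) aM)))

  module RP = Restrict aP (ptsC₀ M) (ptsC₀! M) closedP
  module RL = Restrict aL (lnsC₀ M) (lnsC₀! M) closedL

  auto₀ : Auto (C₀ M) (α₀ M aP aL)
  auto₀ = record
    { rangeP = RP.range ; rangeL = RL.range ; cubeP = RP.cube aP³ ; cubeL = RL.cube aL³
    ; pres = λ p< l< → preserve p< l< }
    where
    preserve : ∀ {i j} → i < np (C₀ M) → j < nl (C₀ M) → incC₀ M i j ≡ true →
               incC₀ M (applyF aP (ptsC₀ M) i) (applyF aL (lnsC₀ M) j) ≡ true
    preserve i< j< h with p , ei ← <⇒nth (ptsC₀ M) i< with l , ej ← <⇒nth (lnsC₀ M) j< =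
      trans (incC₀-nth M (RP.nth-applyF ei) (RL.nth-applyF ej))
        (trans (pres p l) (trans (sym (incC₀-nth M ei ej)) h))

  seed : Seed (C₀ M) (α₀ M aP aL) (numPt M x)
  seed = record
    { partial = record { unique = λ p< q< l< m< → C₀-unique M p< q< l< m< }
    ; auto = auto₀
    ; fixP = fixP₀
    -- A fixed line of 𝒞₀ would be a fixed line of the Fano plane, hence `M`, which has been
    -- removed.
    ; fixL = λ l< fix → let l , e = <⇒nth (lnsC₀ M) l< in
        ∈-lnsC₀⁻ M (nth-∈ (lnsC₀ M) _ e) (only-M l (RL.fixed e fix))
    ; thin = λ p< q< r< l< p≢q p≢r q≢r pl ql rl →
        [ p≢q , [ p≢r , q≢r ]′ ]′ (C₀-thin M p< q< r< l< pl ql rl)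
    ; joins = λ p< q< → C₀-joins M p< q<
    ; four = C₀-four M
    ; x< = nth⇒< (ptsC₀ M) _ nth-x }
    where
    nth-x : nth (ptsC₀ M) (numPt M x) ≡ just x
    nth-x = nth-idx finEq-decides (∈-ptsC₀⁺ M x∉M)
    fixP₀ : ∀ {i} → i < np (C₀ M) → applyF aP (ptsC₀ M) i ≡ i → i ≡ numPt M x
    fixP₀ {i} i< fix with p , e ← <⇒nth (ptsC₀ M) i< with refl ← only-x p (RP.fixed e fix) =
      nth-injective (ptsC₀! M) i (numPt M x) e nth-x

theorem3p2 : (x M : Fin 7) → IncF x M ≡ false →
    (aP aL : Fin 7 ↔ Fin 7) →
    (∀ p l → IncF (Inverse.to aP p) (Inverse.to aL l) ≡ IncF p l) →
    (∀ p → Inverse.to aP (Inverse.to aP (Inverse.to aP p)) ≡ p) →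
    (∀ l → Inverse.to aL (Inverse.to aL (Inverse.to aL l)) ≡ l) →
    (∃ λ p → Inverse.to aP p ≢ p) →
    Inverse.to aP x ≡ x → Inverse.to aL M ≡ M →
    (∀ p → Inverse.to aP p ≡ p → p ≡ x) →
    (∀ l → Inverse.to aL l ≡ l → l ≡ M) →
    let open FreeCompletion (C₀ M)
        open Extension (α₀ M (Inverse.to aP) (Inverse.to aL))
        x̄ = numPt M x
    in (∃ λ L → IsLn L × Inc x̄ L × ∃ λ L′ → ᾱL L L′ × L′ ≢ L)
       × ¬ (∃ λ U → IsLn U × ¬ Inc x̄ U × ∃ λ f → ∃ λ g → IsAut f g × f x̄ ≡ x̄ × g U ≡ U
              × (∀ L → IsLn L → Inc x̄ L → ᾱL L (g L)))
theorem3p2 x M x∉M aP aL pres aP³ aL³ _ _ aM only-x only-M =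
  moves-line-through-x ,
  λ (U , U-ln , x∉U , f , g , γ , _ , gU , agree) → no-fixed-line γ U-ln x∉U gU agree
  where
  open FanoSeed x∉M {Inverse.to aP} {Inverse.to aL} pres aP³ aL³ aM only-x only-M
  open FreePlane seed
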